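{- Let $\Gamma=(V\uplus A,E,\alpha,c,\lambda)$ be a gainy marked network with at least all sinks marked. Then the polyhedron $\mathcal{C}(\Gamma)\subseteq\mathbb{R}^V$ is anti-blocking.
   Context: A convex polyhedron $Q\subseteq\mathbb{R}^V_{\ge0}$ is anti-blocking if for all $y\in Q$ and $x\in\mathbb{R}^V_{\ge0}$ with $x\le y$ componentwise one has $x\in Q$. A marked network $\Gamma=(V\uplus A,E,\alpha,c,\lambda)$ consists of a finite loop-free directed multigraph on the node set $V\uplus A$ with edge set $E$ (nodes in $A$ are called marked, nodes in $V$ unmarked), weights $\alpha_e,c_e\in\mathbb{R}$ with $\alpha_e>0$ for each edge $e\in E$, and a marking $\lambda\in\mathbb{R}^A$. For $x\in\mathbb{R}^V$ one sets $x_a:=\lambda_a$ for $a\in A$. A sink is a node without outgoing edges; "all sinks marked" means every sink lies in $A$. A path is a finite walk with pairwise distinct nodes (length $0$ allowed). A cycle is a finite walk $v_1\xrightarrow{e_1}v_2\to\cdots\xrightarrow{e_r}v_{r+1}=v_1$ ($r\ge 1$) with $v_1,\dots,v_r$ pairwise distinct. The weight of a finite walk with edges $e_1,\dots,e_r$ is $\prod_{i=1}^r\alpha_{e_i}$. The network is gainy if every cycle $C$ has weight $\alpha(C)<1$. $\mathcal{W}$ is the set consisting of all finite walks $v_1\xrightarrow{e_1}\cdots\xrightarrow{e_r}v_{r+1}$ ($r\ge0$) with $v_i\in V$ for $i\le r$ and $v_{r+1}\in A$, and all infinite walks $v_1\xrightarrow{e_1}v_2\xrightarrow{e_2}\cdots$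 with all $v_i\in V$. For $W\in\mathcal{W}$ and $x\in\mathbb{R}^V$: if $W$ is finite, $$\Sigma(W)(x)=\sum_{k=1}^r\Big(\prod_{j=1}^{k-1}\alpha_{e_j}\Big)(x_{v_k}+c_{e_k})+\Big(\prod_{j=1}^r\alpha_{e_j}\Big)x_{v_{r+1}};$$ if $W$ is infinite, $\Sigma(W)(x)=\sum_{k=1}^\infty\big(\prod_{j=1}^{k-1}\alpha_{e_j}\big)(x_{v_k}+c_{e_k})$ (for gainy networks this series converges absolutely). $\widehat{\mathcal{W}}\subseteq\mathcal{W}$ is the subset of walks that are either a path (necessarily ending in a marked node) or a monocycle, i.e. an infinite walk of the form $v_1\xrightarrow{e_1}\cdots\xrightarrow{e_{s-1}}v_s\xrightarrow{e_s}\cdots\xrightarrow{e_{r-1}}v_r\xrightarrow{e_r}v_s\xrightarrow{e_s}\cdots$ which after reaching $v_s$ repeats the cycle $v_s\xrightarrow{e_s}\cdots\xrightarrow{e_{r-1}}v_r\xrightarrow{e_r}v_s$ forever, with $v_1,\dots,v_r\in V$ pairwise distinct and $1\le s\le r$. The polyhedron $\mathcal{C}(\Gamma)\subseteq\mathbb{R}^V$ is the set of all $y\in\mathbb{R}^V$ with $y\ge 0$ (componentwise) and $\alpha_e\Sigma(W)(y)+c_e\le\lambda_a$ for each $a\in A$, each edge $e$ starting in $a$, and each $W\in\widehat{\mathcal{W}}$ starting in the end node of $e$. -}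

module Defs where

open import Level using (0ℓ)
open import Data.Nat as ℕ using (ℕ; suc)
import Data.Nat.Properties as ℕ
open import Data.Rational as ℚ using (ℚ; 0ℚ; 1ℚ; ½)
import Data.Rational.Properties as ℚ
open import Data.Rational.Solver using (module +-*-Solver)
open import Data.Fin using (Fin; Fin′; toℕ; fromℕ; inject; inject₁) renaming (zero to fzero)
open import Data.List using (List)
open import Data.List.Relation.Unary.All using (All)
open import Data.Product using (Σ; ∃-syntax; _×_; _,_; proj₁; proj₂)
open import Data.Sum using (_⊎_; inj₁; inj₂; [_,_]′)
open import Data.Vec.Functional using (Vector; foldr)
open import Function using (_∘_; _⇔_)
open import Function.Definitions using (Injective)
open import Relation.Binary.PropositionalEquality
open import Relation.Unary using (Pred; _∈_)

-- Real numbers are Cauchy sequences of rationals (the Cauchy condition is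
-- proof-relevant, i.e. carries a modulus); equality is the setoid relation
-- _≃_.

IsCauchy : Pred (ℕ → ℚ) 0ℓ
IsCauchy x = ∀ ε → 0ℚ ℚ.< ε →
  ∃[ N ] ∀ m n → N ℕ.≤ m → N ℕ.≤ n → ℚ.∣ x m ℚ.- x n ∣ ℚ.< ε

private
  open +-*-Solver using (solve; _:=_; _:+_; _:*_; _:-_; :-_)
  open ℚ.≤-Reasoning hiding (start)

  abstract
    +-diff : ∀ a b c d → (a ℚ.+ b) ℚ.- (c ℚ.+ d) ≡ (a ℚ.- c) ℚ.+ (b ℚ.- d)
    +-diff = solve 4 (λ a b c d → (a :+ b) :- (c :+ d) := (a :- c) :+ (b :- d)) refl

    *-diff : ∀ a b c d → a ℚ.* b ℚ.- c ℚ.* d ≡ a ℚ.* (b ℚ.- d) ℚ.+ d ℚ.* (a ℚ.- c)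
    *-diff = solve 4 (λ a b c d → a :* b :- c :* d := a :* (b :- d) :+ d :* (a :- c)) refl

    neg-diff : ∀ a b → (ℚ.- a) ℚ.- (ℚ.- b) ≡ ℚ.- (a ℚ.- b)
    neg-diff = solve 2 (λ a b → (:- a) :- (:- b) := :- (a :- b)) refl

    diff-+ : ∀ a b → a ≡ (a ℚ.- b) ℚ.+ b
    diff-+ = solve 2 (λ a b → a := (a :- b) :+ b) refl

    +-diff-cancel : ∀ a b → (a ℚ.+ b) ℚ.- b ≡ a
    +-diff-cancel = solve 2 (λ a b → (a :+ b) :- b := a) refl

    swap-diff : ∀ a b → ℚ.- (a ℚ.- b) ≡ b ℚ.- a
    swap-diff = solve 2 (λ a b → :- (a :- b) := b :- a) refl

    halves : ∀ ε → ½ ℚ.* ε ℚ.+ ½ ℚ.* ε ≡ ε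
    halves ε = trans (sym (ℚ.*-distribʳ-+ ε ½ ½)) (ℚ.*-identityˡ ε)

    half-pos : ∀ {ε} → 0ℚ ℚ.< ε → 0ℚ ℚ.< ½ ℚ.* ε
    half-pos {ε} ε>0 =
      ℚ.positive⁻¹ (½ ℚ.* ε) {{ℚ.pos*pos⇒pos ½ ε {{ℚ.positive ε>0}}}}

    ∣p∣-∣q∣≤∣p-q∣ : ∀ p q → ℚ.∣ p ∣ ℚ.- ℚ.∣ q ∣ ℚ.≤ ℚ.∣ p ℚ.- q ∣
    ∣p∣-∣q∣≤∣p-q∣ p q = begin
      ℚ.∣ p ∣ ℚ.- ℚ.∣ q ∣
        ≡⟨ cong (λ z → ℚ.∣ z ∣ ℚ.- ℚ.∣ q ∣) (diff-+ p q) ⟩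
      ℚ.∣ (p ℚ.- q) ℚ.+ q ∣ ℚ.- ℚ.∣ q ∣
        ≤⟨ ℚ.+-monoˡ-≤ (ℚ.- ℚ.∣ q ∣) (ℚ.∣p+q∣≤∣p∣+∣q∣ (p ℚ.- q) q) ⟩
      (ℚ.∣ p ℚ.- q ∣ ℚ.+ ℚ.∣ q ∣) ℚ.- ℚ.∣ q ∣
        ≡⟨ +-diff-cancel ℚ.∣ p ℚ.- q ∣ ℚ.∣ q ∣ ⟩
      ℚ.∣ p ℚ.- q ∣ ∎

    ∣p-q∣≡∣q-p∣ : ∀ p q → ℚ.∣ p ℚ.- q ∣ ≡ ℚ.∣ q ℚ.- p ∣
    ∣p-q∣≡∣q-p∣ p q =
      trans (sym (ℚ.∣-p∣≡∣p∣ (p ℚ.- q))) (cong ℚ.∣_∣ (swap-diff p q))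

    ∣∣p∣-∣q∣∣≤∣p-q∣ : ∀ p q → ℚ.∣ ℚ.∣ p ∣ ℚ.- ℚ.∣ q ∣ ∣ ℚ.≤ ℚ.∣ p ℚ.- q ∣
    ∣∣p∣-∣q∣∣≤∣p-q∣ p q with ℚ.∣p∣≡p∨∣p∣≡-p (ℚ.∣ p ∣ ℚ.- ℚ.∣ q ∣)
    ... | inj₁ eq = ℚ.≤-trans (ℚ.≤-reflexive eq) (∣p∣-∣q∣≤∣p-q∣ p q)
    ... | inj₂ eq = begin
      ℚ.∣ ℚ.∣ p ∣ ℚ.- ℚ.∣ q ∣ ∣  ≡⟨ trans eq (swap-diff ℚ.∣ p ∣ ℚ.∣ q ∣) ⟩
      ℚ.∣ q ∣ ℚ.- ℚ.∣ p ∣        ≤⟨ ∣p∣-∣q∣≤∣p-q∣ q p ⟩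
      ℚ.∣ q ℚ.- p ∣              ≡⟨ ∣p-q∣≡∣q-p∣ q p ⟩
      ℚ.∣ p ℚ.- q ∣              ∎

    const-cauchy : ∀ q → IsCauchy (λ _ → q)
    const-cauchy q ε ε>0 =
      0 , λ _ _ _ _ → subst (λ z → ℚ.∣ z ∣ ℚ.< ε) (sym (ℚ.+-inverseʳ q)) ε>0

    +-cauchy : ∀ {x y} → IsCauchy x → IsCauchy y → IsCauchy (λ n → x n ℚ.+ y n)
    +-cauchy {x} {y} cx cy ε ε>0
      with cx (½ ℚ.* ε) (half-pos ε>0) | cy (½ ℚ.* ε) (half-pos ε>0)
    ... | N , hx | M , hy = N ℕ.⊔ M , λ m n N≤m N≤n → begin-strict
      ℚ.∣ (x m ℚ.+ y m) ℚ.- (x n ℚ.+ y n) ∣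
        ≡⟨ cong ℚ.∣_∣ (+-diff (x m) (y m) (x n) (y n)) ⟩
      ℚ.∣ (x m ℚ.- x n) ℚ.+ (y m ℚ.- y n) ∣
        ≤⟨ ℚ.∣p+q∣≤∣p∣+∣q∣ (x m ℚ.- x n) (y m ℚ.- y n) ⟩
      ℚ.∣ x m ℚ.- x n ∣ ℚ.+ ℚ.∣ y m ℚ.- y n ∣
        <⟨ ℚ.+-mono-< (hx m n (ℕ.m⊔n≤o⇒m≤o N M N≤m) (ℕ.m⊔n≤o⇒m≤o N M N≤n))
                      (hy m n (ℕ.m⊔n≤o⇒n≤o N M N≤m) (ℕ.m⊔n≤o⇒n≤o N M N≤n)) ⟩
      ½ ℚ.* ε ℚ.+ ½ ℚ.* ε
        ≡⟨ halves ε ⟩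
      ε ∎

    neg-cauchy : ∀ {x} → IsCauchy x → IsCauchy (λ n → ℚ.- x n)
    neg-cauchy {x} cx ε ε>0 with cx ε ε>0
    ... | N , h = N , λ m n N≤m N≤n →
      subst (ℚ._< ε)
        (sym (trans (cong ℚ.∣_∣ (neg-diff (x m) (x n))) (ℚ.∣-p∣≡∣p∣ (x m ℚ.- x n))))
        (h m n N≤m N≤n)

    abs-cauchy : ∀ {x} → IsCauchy x → IsCauchy (λ n → ℚ.∣ x n ∣)
    abs-cauchy {x} cx ε ε>0 with cx ε ε>0
    ... | N , h = N , λ m n N≤m N≤n →
      ℚ.≤-<-trans (∣∣p∣-∣q∣∣≤∣p-q∣ (x m) (x n)) (h m n N≤m N≤n)

    cauchy-bound : ∀ {x} → IsCauchy x →
      ∃[ B ] 0ℚ ℚ.< B × ∃[ N ] ∀ n → N ℕ.≤ n → ℚ.∣ x n ∣ ℚ.< B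
    cauchy-bound {x} cx with cx 1ℚ (ℚ.positive⁻¹ 1ℚ)
    ... | N , h =
      1ℚ ℚ.+ ℚ.∣ x N ∣ ,
      ℚ.+-mono-<-≤ (ℚ.positive⁻¹ 1ℚ) (ℚ.0≤∣p∣ (x N)) ,
      N , λ n N≤n → begin-strict
        ℚ.∣ x n ∣                       ≡⟨ cong ℚ.∣_∣ (diff-+ (x n) (x N)) ⟩
        ℚ.∣ (x n ℚ.- x N) ℚ.+ x N ∣     ≤⟨ ℚ.∣p+q∣≤∣p∣+∣q∣ (x n ℚ.- x N) (x N) ⟩
        ℚ.∣ x n ℚ.- x N ∣ ℚ.+ ℚ.∣ x N ∣ <⟨ ℚ.+-monoˡ-< ℚ.∣ x N ∣ (h n N N≤n ℕ.≤-refl) ⟩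
        1ℚ ℚ.+ ℚ.∣ x N ∣                ∎

    *-bound : ∀ {p q B δ} → 0ℚ ℚ.< B → ℚ.∣ p ∣ ℚ.< B → ℚ.∣ q ∣ ℚ.< δ →
              ℚ.∣ p ℚ.* q ∣ ℚ.< B ℚ.* δ
    *-bound {p} {q} {B} {δ} B>0 p<B q<δ = begin-strict
      ℚ.∣ p ℚ.* q ∣        ≡⟨ ℚ.∣p*q∣≡∣p∣*∣q∣ p q ⟩
      ℚ.∣ p ∣ ℚ.* ℚ.∣ q ∣  ≤⟨ ℚ.*-monoʳ-≤-nonNeg ℚ.∣ q ∣ {{ℚ.∣-∣-nonNeg q}} (ℚ.<⇒≤ p<B) ⟩
      B ℚ.* ℚ.∣ q ∣        <⟨ ℚ.*-monoʳ-<-pos B {{ℚ.positive B>0}} q<δ ⟩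
      B ℚ.* δ              ∎

    divide : ∀ D ε → 0ℚ ℚ.< D → 0ℚ ℚ.< ε → ∃[ δ ] 0ℚ ℚ.< δ × D ℚ.* δ ≡ ε
    divide D ε D>0 ε>0 = (ℚ.1/ D) ℚ.* ε , δ>0 , Dδ≡ε
      where
      instance
        D-pos : ℚ.Positive D
        D-pos = ℚ.positive D>0
        D≢0 : ℚ.NonZero D
        D≢0 = ℚ.pos⇒nonZero D
      δ>0 : 0ℚ ℚ.< (ℚ.1/ D) ℚ.* ε
      δ>0 = ℚ.positive⁻¹ ((ℚ.1/ D) ℚ.* ε)
        {{ℚ.pos*pos⇒pos (ℚ.1/ D) {{ℚ.1/pos⇒pos D}} ε {{ℚ.positive ε>0}}}}
      Dδ≡ε : D ℚ.* ((ℚ.1/ D) ℚ.* ε) ≡ ε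
      Dδ≡ε = trans (sym (ℚ.*-assoc D (ℚ.1/ D) ε))
                   (trans (cong (ℚ._* ε) (ℚ.*-inverseʳ D)) (ℚ.*-identityˡ ε))

    *-close : ∀ {a b c d B C δ ε} → 0ℚ ℚ.< B → 0ℚ ℚ.< C → (B ℚ.+ C) ℚ.* δ ≡ ε →
              ℚ.∣ a ∣ ℚ.< B → ℚ.∣ d ∣ ℚ.< C →
              ℚ.∣ a ℚ.- c ∣ ℚ.< δ → ℚ.∣ b ℚ.- d ∣ ℚ.< δ →
              ℚ.∣ a ℚ.* b ℚ.- c ℚ.* d ∣ ℚ.< ε
    *-close {a} {b} {c} {d} {B} {C} {δ} {ε} B>0 C>0 eq a<B d<C ac bd = begin-strict
      ℚ.∣ a ℚ.* b ℚ.- c ℚ.* d ∣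
        ≡⟨ cong ℚ.∣_∣ (*-diff a b c d) ⟩
      ℚ.∣ a ℚ.* (b ℚ.- d) ℚ.+ d ℚ.* (a ℚ.- c) ∣
        ≤⟨ ℚ.∣p+q∣≤∣p∣+∣q∣ (a ℚ.* (b ℚ.- d)) (d ℚ.* (a ℚ.- c)) ⟩
      ℚ.∣ a ℚ.* (b ℚ.- d) ∣ ℚ.+ ℚ.∣ d ℚ.* (a ℚ.- c) ∣
        <⟨ ℚ.+-mono-< (*-bound {a} {b ℚ.- d} B>0 a<B bd)
                      (*-bound {d} {a ℚ.- c} C>0 d<C ac) ⟩
      B ℚ.* δ ℚ.+ C ℚ.* δ
        ≡⟨ sym (ℚ.*-distribʳ-+ δ B C) ⟩
      (B ℚ.+ C) ℚ.* δ
        ≡⟨ eq ⟩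
      ε ∎

    *-cauchy : ∀ {x y} → IsCauchy x → IsCauchy y → IsCauchy (λ n → x n ℚ.* y n)
    *-cauchy {x} {y} cx cy ε ε>0 =
      let B , B>0 , N₁ , hB = cauchy-bound {x} cx
          C , C>0 , N₂ , hC = cauchy-bound {y} cy
          δ , δ>0 , eq = divide (B ℚ.+ C) ε (ℚ.+-mono-< B>0 C>0) ε>0
          N₃ , hx = cx δ δ>0
          N₄ , hy = cy δ δ>0
          M₁ = N₁ ℕ.⊔ N₂
          M₂ = N₃ ℕ.⊔ N₄
      in M₁ ℕ.⊔ M₂ , λ m n N≤m N≤n →
        *-close {x m} {y m} {x n} {y n} B>0 C>0 eq
          (hB m (ℕ.m⊔n≤o⇒m≤o N₁ N₂ (ℕ.m⊔n≤o⇒m≤o M₁ M₂ N≤m)))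
          (hC n (ℕ.m⊔n≤o⇒n≤o N₁ N₂ (ℕ.m⊔n≤o⇒m≤o M₁ M₂ N≤n)))
          (hx m n (ℕ.m⊔n≤o⇒m≤o N₃ N₄ (ℕ.m⊔n≤o⇒n≤o M₁ M₂ N≤m))
                  (ℕ.m⊔n≤o⇒m≤o N₃ N₄ (ℕ.m⊔n≤o⇒n≤o M₁ M₂ N≤n)))
          (hy m n (ℕ.m⊔n≤o⇒n≤o N₃ N₄ (ℕ.m⊔n≤o⇒n≤o M₁ M₂ N≤m))
                  (ℕ.m⊔n≤o⇒n≤o N₃ N₄ (ℕ.m⊔n≤o⇒n≤o M₁ M₂ N≤n)))

record ℝ : Set where
  constructor mkℝ
  field
    seq    : ℕ → ℚ
    cauchy : IsCauchy seq
open ℝ public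

infix  4 _≃_ _≤_ _<_
infixl 6 _+_ _-_
infixl 7 _*_
infix  8 -_

_≃_ : ℝ → ℝ → Set
x ≃ y = ∀ ε → 0ℚ ℚ.< ε → ∃[ N ] ∀ n → N ℕ.≤ n → ℚ.∣ seq x n ℚ.- seq y n ∣ ℚ.< ε

_≤_ : ℝ → ℝ → Set
x ≤ y = ∀ ε → 0ℚ ℚ.< ε → ∃[ N ] ∀ n → N ℕ.≤ n → seq x n ℚ.< seq y n ℚ.+ ε

_<_ : ℝ → ℝ → Set
x < y = ∃[ ε ] 0ℚ ℚ.< ε × ∃[ N ] ∀ n → N ℕ.≤ n → seq x n ℚ.+ ε ℚ.< seq y n

fromℚ : ℚ → ℝ
fromℚ q = mkℝ (λ _ → q) (const-cauchy q)

0ℝ 1ℝ : ℝ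
0ℝ = fromℚ 0ℚ
1ℝ = fromℚ 1ℚ

_+_ _*_ : ℝ → ℝ → ℝ
x + y = mkℝ (λ n → seq x n ℚ.+ seq y n) (+-cauchy {seq x} {seq y} (cauchy x) (cauchy y))
x * y = mkℝ (λ n → seq x n ℚ.* seq y n) (*-cauchy {seq x} {seq y} (cauchy x) (cauchy y))

-_ : ℝ → ℝ
- x = mkℝ (λ n → ℚ.- seq x n) (neg-cauchy {seq x} (cauchy x))

_-_ : ℝ → ℝ → ℝ
x - y = x + (- y)

∣_∣ : ℝ → ℝ
∣ x ∣ = mkℝ (λ n → ℚ.∣ seq x n ∣) (abs-cauchy {seq x} (cauchy x))

∑ ∏ : ∀ {n} → Vector ℝ n → ℝ
∑ = foldr _+_ 0ℝ
∏ = foldr _*_ 1ℝ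

HasSum : (ℕ → ℝ) → ℝ → Set
HasSum f s = ∀ ε → 0ℝ < ε →
  ∃[ N ] ∀ n → N ℕ.≤ n → ∣ ∑ {n} (f ∘ toℕ) - s ∣ < ε

infix 4 _≤ᵛ_

_≤ᵛ_ : ∀ {n} → Vector ℝ n → Vector ℝ n → Set
x ≤ᵛ y = ∀ i → x i ≤ y i

0ᵛ : ∀ {n} → Vector ℝ n
0ᵛ _ = 0ℝ

-- A finite intersection of closed half-spaces a · x ≤ b.
IsPolyhedron : ∀ {n} → Pred (Vector ℝ n) 0ℓ → Set
IsPolyhedron {n} Q =
  Σ (List (Vector ℝ n × ℝ)) λ H →
    ∀ x → x ∈ Q ⇔ All (λ (a , b) → ∑ (λ i → a i * x i) ≤ b) H

record IsAntiBlocking {n} (Q : Pred (Vector ℝ n) 0ℓ) : Set where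
  field
    polyhedron  : IsPolyhedron Q
    nonNegative : ∀ x → x ∈ Q → 0ᵛ ≤ᵛ x
    downClosed  : ∀ x y → y ∈ Q → 0ᵛ ≤ᵛ x → x ≤ᵛ y → x ∈ Q

-- Unmarked nodes (V) are `inj₁ v`, marked nodes (A) are `inj₂ a`.
record MarkedNetwork : Set where
  field
    #V #A #E : ℕ

  V : Set
  V = Fin #V

  A : Set
  A = Fin #A

  E : Set
  E = Fin #E

  Node : Set
  Node = V ⊎ A

  field
    src tgt  : E → Node
    loopFree : ∀ e → src e ≢ tgt e
    α c      : E → ℝ
    α-pos    : ∀ e → 0ℝ < α e
    mark     : Vector ℝ #A

module _ (Γ : MarkedNetwork) where
  open MarkedNetwork Γ

  IsUnmarked IsMarked IsSink : Pred Node 0ℓ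
  IsUnmarked u = ∃[ v ] u ≡ inj₁ v
  IsMarked u   = ∃[ a ] u ≡ inj₂ a
  IsSink u     = ∀ e → src e ≢ u

  AllSinksMarked : Set
  AllSinksMarked = ∀ u → IsSink u → IsMarked u

  -- Indices are shifted: node 0 is v₁ and edge 0 is e₁; `length` is the
  -- number of edges.
  record FiniteWalk : Set where
    field
      length : ℕ
      node   : Fin (suc length) → Node
      edge   : Fin length → E
      src≡   : ∀ i → src (edge i) ≡ node (inject₁ i)
      tgt≡   : ∀ i → tgt (edge i) ≡ node (Fin.suc i)

  record InfiniteWalk : Set where
    field
      node : ℕ → Node
      edge : ℕ → E
      src≡ : ∀ i → src (edge i) ≡ node i
      tgt≡ : ∀ i → tgt (edge i) ≡ node (suc i)

  weight : FiniteWalk → ℝ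
  weight W = ∏ (α ∘ edge)
    where open FiniteWalk W

  IsPath : Pred FiniteWalk 0ℓ
  IsPath W = Injective _≡_ _≡_ node
    where open FiniteWalk W

  IsCycle : Pred FiniteWalk 0ℓ
  IsCycle W =
    1 ℕ.≤ length ×
    node (fromℕ length) ≡ node fzero ×
    Injective _≡_ _≡_ (node ∘ inject₁)
    where open FiniteWalk W

  IsGainy : Set
  IsGainy = ∀ C → IsCycle C → weight C < 1ℝ

  data 𝒲 : Set where
    finite   : (W : FiniteWalk) →
               (∀ i → IsUnmarked (FiniteWalk.node W (inject₁ i))) →
               IsMarked (FiniteWalk.node W (fromℕ (FiniteWalk.length W))) → 𝒲
    infinite : (W : InfiniteWalk) →
               (∀ i → IsUnmarked (InfiniteWalk.node W i)) → 𝒲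

  start : 𝒲 → Node
  start (finite W _ _)  = FiniteWalk.node W fzero
  start (infinite W _)  = InfiniteWalk.node W 0

  -- x extended by xₐ = λₐ
  extend : Vector ℝ #V → Node → ℝ
  extend x = [ x , mark ]′

  -- `HasΣ W x s` says that Σ(W)(x) is defined and equals s; for infinite
  -- W this means that the series converges to s.
  HasΣ : 𝒲 → Vector ℝ #V → ℝ → Set
  HasΣ (finite W _ _) x s =
    s ≃ ∑ (λ k → ∏ (λ (j : Fin′ k) → α (edge (inject j))) *
                 (extend x (node (inject₁ k)) + c (edge k)))
        + ∏ (α ∘ edge) * extend x (node (fromℕ length))
    where open FiniteWalk W
  HasΣ (infinite W _) x s =
    HasSum (λ k → ∏ {k} (λ j → α (edge (toℕ j))) * (extend x (node k) + c (edge k))) s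
    where open InfiniteWalk W

  -- The stem has nodes 0 … s, the cycle nodes s … r; the periodicity of
  -- `edge` forces that of `node`.
  IsMonocycle : Pred InfiniteWalk 0ℓ
  IsMonocycle W = ∃[ s ] ∃[ r ]
    s ℕ.≤ r ×
    (∀ i j → i ℕ.≤ r → j ℕ.≤ r → node i ≡ node j → i ≡ j) ×
    (∀ i → s ℕ.≤ i → edge (i ℕ.+ (suc r ℕ.∸ s)) ≡ edge i)
    where open InfiniteWalk W

  Ŵ : Pred 𝒲 0ℓ
  Ŵ (finite W _ _) = IsPath W
  Ŵ (infinite W _) = IsMonocycle W

  -- The inequality is about Σ(W)(y) as a value, so its existence is part of
  -- the condition; it is automatic in gainy networks.
  𝒞 : Pred (Vector ℝ #V) 0ℓ
  𝒞 y =
    0ᵛ ≤ᵛ y ×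
    (∀ a e W → src e ≡ inj₂ a → W ∈ Ŵ → start W ≡ tgt e →
      ∃[ σ ] HasΣ W y σ × α e * σ + c e ≤ mark a)

{-# OPTIONS --safe #-}
module Submission where

open import Defs

open import Algebra.Bundles using (CommutativeRing)
import Algebra.Properties.Semiring.Sum as SemiringSum
open import Data.Fin as Fin using (Fin; Fin′; toℕ; fromℕ; fromℕ<; inject; inject₁; lower₁; splitAt; finToFun; funToFin)
  renaming (zero to fzero; suc to fsuc)
import Data.Fin.Properties as Fin
import Data.Integer as ℤ
import Data.Integer.Properties as ℤ
open import Data.List using ([]; _∷_; _++_)
open import Data.List.Relation.Unary.All using ([]; _∷_)
import Data.List.Relation.Unary.All.Properties as All
open import Data.Nat as ℕ using (ℕ; zero; suc)
open import Data.Nat.Induction using (<-rec)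
import Data.Nat.Properties as ℕ
open import Data.Product using (Σ; ∃-syntax; _×_; _,_; proj₁; proj₂)
open import Data.Rational as ℚ using (ℚ; 0ℚ; 1ℚ; ½)
import Data.Rational.Properties as ℚ
open import Data.Rational.Solver using (module +-*-Solver)
import Data.Rational.Unnormalised as ℚᵘ
import Data.Rational.Unnormalised.Properties as ℚᵘ
open import Data.Sum using (inj₁; inj₂; [_,_]′)
import Data.Sum.Properties as Sum⊎
open import Data.Vec.Functional using (Vector)
open import Function using (_∘_; _⇔_; mk⇔; Equivalence)
open import Function.Definitions using (Injective)
open import Level using (0ℓ)
open import Relation.Binary.Definitions using (DecidableEquality)
open import Relation.Binary.PropositionalEquality
import Relation.Binary.Reasoning.Base.Double
open import Relation.Binary.Structures using (IsPreorder)
open import Relation.Nullary using (Dec; yes; no; contradiction; _×-dec_; _→-dec_)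
open import Relation.Unary using (Pred; _∈_)

-- For a walk W in Ŵ the value Σ(W)(x) exists and is affine in x: a finite walk
-- gives a finite sum, and on a monocycle with cycle weight w < 1 the sum t along
-- the cycle solves t = S + w t, where S is the sum of one round.  All x_v
-- enter with nonnegative coefficients because α > 0, so Σ(W)(x) ≤ Σ(W)(y)
-- whenever x ≤ y, which makes 𝒞(Γ) downward closed.  Only finitely many W
-- matter, since a path or a monocycle is determined by at most |V| + |A| edges
-- and the index at which it closes up; hence 𝒞(Γ) is a polyhedron.

-- Real numbers

-- The order on these reals is not decidable, so estimates need explicit rational margins. The
-- hypothesis `weight C < 1ℝ` carries one, η, which does two jobs: it makes 1 - w invertible, and it
-- forces convergence, because each round multiplies the distance to the fixed point by w and w is
-- eventually below 1 - η. Membership in `𝒞` asserts that the sum exists, as some σ. Monotonicity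
-- alone therefore cannot pass from y to a smaller x: the affine formula must first produce a value
-- at x. The same formula turns the existential into one linear inequality, since two values of one
-- sum are equal. Finiteness must yield an actual list of half-spaces. Walks contain functions and
-- proofs and cannot be listed; codes in finite types are listed instead, and a decidable test sorts
-- out the invalid ones. A walk agrees with the walk of its code only pointwise, so its sum has to
-- be transported. Codes record edges, because nodes do not tell parallel edges apart.

Eventually : Pred (Pred ℕ 0ℓ) 0ℓ
Eventually P = ∃[ N ] ∀ n → N ℕ.≤ n → P n

module _ {P Q R : Pred ℕ 0ℓ} where

  eventually-zip : (∀ {n} → P n → Q n → R n) →
                   Eventually P → Eventually Q → Eventually R
  eventually-zip f (N , p) (M , q) = N ℕ.⊔ M , λ n N⊔M≤n →
    f (p n (ℕ.m⊔n≤o⇒m≤o N M N⊔M≤n)) (q n (ℕ.m⊔n≤o⇒n≤o N M N⊔M≤n))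

eventually-map : ∀ {P Q : Pred ℕ 0ℓ} → (∀ {n} → P n → Q n) → Eventually P → Eventually Q
eventually-map f (N , p) = N , λ n N≤n → f (p n N≤n)

module _ where
  open +-*-Solver using (solve; _:=_; _:+_; _:*_; _:-_; :-_)
  open ℚ.≤-Reasoning

  p≡p-q+q : ∀ p q → p ≡ (p ℚ.- q) ℚ.+ q
  p≡p-q+q = solve 2 (λ p q → p := (p :- q) :+ q) refl

  half-positive : ∀ {ε} → 0ℚ ℚ.< ε → 0ℚ ℚ.< ½ ℚ.* ε
  half-positive {ε} ε>0 =
    ℚ.positive⁻¹ (½ ℚ.* ε) {{ℚ.pos*pos⇒pos ½ ε {{ℚ.positive ε>0}}}}

  half+half : ∀ ε → ½ ℚ.* ε ℚ.+ ½ ℚ.* ε ≡ ε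
  half+half ε = trans (sym (ℚ.*-distribʳ-+ ε ½ ½)) (ℚ.*-identityˡ ε)

  p<p+q : ∀ p {q} → 0ℚ ℚ.< q → p ℚ.< p ℚ.+ q
  p<p+q p {q} q>0 = begin-strict
    p           ≡⟨ sym (ℚ.+-identityʳ p) ⟩
    p ℚ.+ 0ℚ    <⟨ ℚ.+-monoʳ-< p q>0 ⟩
    p ℚ.+ q     ∎

  half< : ∀ {ε} → 0ℚ ℚ.< ε → ½ ℚ.* ε ℚ.< ε
  half< {ε} ε>0 = begin-strict
    ½ ℚ.* ε               <⟨ p<p+q (½ ℚ.* ε) (half-positive ε>0) ⟩
    ½ ℚ.* ε ℚ.+ ½ ℚ.* ε   ≡⟨ half+half ε ⟩
    ε                     ∎

  p≤∣p∣ : ∀ p → p ℚ.≤ ℚ.∣ p ∣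
  p≤∣p∣ p with ℚ.≤-total 0ℚ p
  ... | inj₁ 0≤p = ℚ.≤-reflexive (sym (ℚ.0≤p⇒∣p∣≡p 0≤p))
  ... | inj₂ p≤0 = ℚ.≤-trans p≤0 (ℚ.0≤∣p∣ p)

  ∣p-q∣≡∣q-p∣ : ∀ p q → ℚ.∣ p ℚ.- q ∣ ≡ ℚ.∣ q ℚ.- p ∣
  ∣p-q∣≡∣q-p∣ p q = trans (sym (ℚ.∣-p∣≡∣p∣ (p ℚ.- q)))
    (cong ℚ.∣_∣ (solve 2 (λ p q → :- (p :- q) := q :- p) refl p q))

  ∣p-q∣<ε⇒p<q+ε : ∀ {p q ε} → ℚ.∣ p ℚ.- q ∣ ℚ.< ε → p ℚ.< q ℚ.+ ε
  ∣p-q∣<ε⇒p<q+ε {p} {q} {ε} h = begin-strict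
    p                     ≡⟨ p≡p-q+q p q ⟩
    (p ℚ.- q) ℚ.+ q       ≤⟨ ℚ.+-monoˡ-≤ q (p≤∣p∣ (p ℚ.- q)) ⟩
    ℚ.∣ p ℚ.- q ∣ ℚ.+ q   <⟨ ℚ.+-monoˡ-< q h ⟩
    ε ℚ.+ q               ≡⟨ ℚ.+-comm ε q ⟩
    q ℚ.+ ε               ∎

  p<q+ε⇒p-q<ε : ∀ {p q ε} → p ℚ.< q ℚ.+ ε → p ℚ.- q ℚ.< ε
  p<q+ε⇒p-q<ε {p} {q} {ε} h = begin-strict
    p ℚ.- q           <⟨ ℚ.+-monoˡ-< (ℚ.- q) h ⟩
    (q ℚ.+ ε) ℚ.- q   ≡⟨ solve 2 (λ q ε → (q :+ ε) :- q := ε) refl q ε ⟩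
    ε                 ∎

  ∣p-q∣<ε : ∀ {p q ε} → p ℚ.< q ℚ.+ ε → q ℚ.< p ℚ.+ ε → ℚ.∣ p ℚ.- q ∣ ℚ.< ε
  ∣p-q∣<ε {p} {q} {ε} h k with ℚ.∣p∣≡p∨∣p∣≡-p (p ℚ.- q)
  ... | inj₁ eq = subst (ℚ._< ε) (sym eq) (p<q+ε⇒p-q<ε h)
  ... | inj₂ eq = subst (ℚ._< ε)
    (trans (solve 2 (λ p q → q :- p := :- (p :- q)) refl p q) (sym eq)) (p<q+ε⇒p-q<ε k)

  ℚ-reciprocal : ∀ {p} → 0ℚ ℚ.< p → ∃[ q ] 0ℚ ℚ.< q × p ℚ.* q ≡ 1ℚ
  ℚ-reciprocal {p} p>0 =
    ℚ.1/ p , ℚ.positive⁻¹ (ℚ.1/ p) {{ℚ.1/pos⇒pos p}} , ℚ.*-inverseʳ p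
    where
    instance
      p-pos : ℚ.Positive p
      p-pos = ℚ.positive p>0
      p≢0 : ℚ.NonZero p
      p≢0 = ℚ.pos⇒nonZero p

  *-positive : ∀ {p q} → 0ℚ ℚ.< p → 0ℚ ℚ.< q → 0ℚ ℚ.< p ℚ.* q
  *-positive {p} {q} p>0 q>0 = ℚ.positive⁻¹ (p ℚ.* q)
    {{ℚ.pos*pos⇒pos p {{ℚ.positive p>0}} q {{ℚ.positive q>0}}}}

  ℚ-divide : ∀ {p ε} → 0ℚ ℚ.< p → 0ℚ ℚ.< ε → ∃[ δ ] 0ℚ ℚ.< δ × p ℚ.* δ ≡ ε
  ℚ-divide {p} {ε} p>0 ε>0 with ℚ-reciprocal p>0
  ... | q , q>0 , pq≡1 = q ℚ.* ε , *-positive q>0 ε>0 ,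
    trans (sym (ℚ.*-assoc p q ε)) (trans (cong (ℚ._* ε) pq≡1) (ℚ.*-identityˡ ε))

  eventually-bounded : ∀ x → ∃[ B ] 0ℚ ℚ.< B × Eventually (λ n → ℚ.∣ seq x n ∣ ℚ.< B)
  eventually-bounded x with cauchy x 1ℚ (ℚ.positive⁻¹ 1ℚ)
  ... | N , h = 1ℚ ℚ.+ ℚ.∣ seq x N ∣ ,
    ℚ.+-mono-<-≤ (ℚ.positive⁻¹ 1ℚ) (ℚ.0≤∣p∣ (seq x N)) ,
    N , λ n N≤n → begin-strict
      ℚ.∣ seq x n ∣
        ≡⟨ cong ℚ.∣_∣ (p≡p-q+q (seq x n) (seq x N)) ⟩
      ℚ.∣ (seq x n ℚ.- seq x N) ℚ.+ seq x N ∣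
        ≤⟨ ℚ.∣p+q∣≤∣p∣+∣q∣ (seq x n ℚ.- seq x N) (seq x N) ⟩
      ℚ.∣ seq x n ℚ.- seq x N ∣ ℚ.+ ℚ.∣ seq x N ∣
        <⟨ ℚ.+-monoˡ-< ℚ.∣ seq x N ∣ (h n N N≤n ℕ.≤-refl) ⟩
      1ℚ ℚ.+ ℚ.∣ seq x N ∣ ∎

infix 4 _≈_ _≼_

-- Defs._≃_ and Defs._≤_ unfold to Π-types, from which Agda cannot infer the
-- two reals; the record versions keep them inferable.
record _≈_ (x y : ℝ) : Set where
  constructor wrap
  field unwrap : x ≃ y

record _≼_ (x y : ℝ) : Set where
  constructor wrap
  field unwrap : x ≤ y

open _≈_ public using () renaming (unwrap to ≈⇒≃)
open _≼_ public using () renaming (unwrap to ≼⇒≤)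

module _ where
  open +-*-Solver using (solve; _:=_; _:+_; _:*_; _:-_; :-_)
  open ℚ.≤-Reasoning

  eventually-≼ : ∀ {x y} → Eventually (λ n → seq x n ℚ.≤ seq y n) → x ≼ y
  eventually-≼ {x} {y} h = wrap λ ε ε>0 → eventually-map
    (λ {n} x≤y → ℚ.≤-<-trans x≤y (p<p+q (seq y n) ε>0)) h

  pointwise-≼ : ∀ {x y} → (∀ n → seq x n ℚ.≤ seq y n) → x ≼ y
  pointwise-≼ h = eventually-≼ (0 , λ n _ → h n)

  ≼-antisym : ∀ {x y} → x ≼ y → y ≼ x → x ≈ y
  ≼-antisym (wrap p) (wrap q) = wrap λ ε ε>0 →
    eventually-zip ∣p-q∣<ε (p ε ε>0) (q ε ε>0)

  ≈⇒≼ : ∀ {x y} → x ≈ y → x ≼ y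
  ≈⇒≼ (wrap p) = wrap λ ε ε>0 → eventually-map ∣p-q∣<ε⇒p<q+ε (p ε ε>0)

  ≈⇒≽ : ∀ {x y} → x ≈ y → y ≼ x
  ≈⇒≽ {x} {y} (wrap p) = wrap λ ε ε>0 → eventually-map
    (λ {n} h → ∣p-q∣<ε⇒p<q+ε (subst (ℚ._< ε) (∣p-q∣≡∣q-p∣ (seq x n) (seq y n)) h)) (p ε ε>0)

  ≼-refl : ∀ {x} → x ≼ x
  ≼-refl = pointwise-≼ λ _ → ℚ.≤-refl

  ≼-trans : ∀ {x y z} → x ≼ y → y ≼ z → x ≼ z
  ≼-trans {x} {y} {z} (wrap p) (wrap q) = wrap λ ε ε>0 →
    let δ = ½ ℚ.* ε; δ>0 = half-positive ε>0 in
    eventually-zip (λ {n} h k → begin-strict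
      seq x n                   <⟨ h ⟩
      seq y n ℚ.+ δ             <⟨ ℚ.+-monoˡ-< δ k ⟩
      (seq z n ℚ.+ δ) ℚ.+ δ     ≡⟨ ℚ.+-assoc (seq z n) δ δ ⟩
      seq z n ℚ.+ (δ ℚ.+ δ)     ≡⟨ cong (seq z n ℚ.+_) (half+half ε) ⟩
      seq z n ℚ.+ ε             ∎) (p δ δ>0) (q δ δ>0)

  pointwise-≈ : ∀ {x y} → (∀ n → seq x n ≡ seq y n) → x ≈ y
  pointwise-≈ h = ≼-antisym (pointwise-≼ (λ n → ℚ.≤-reflexive (h n)))
                            (pointwise-≼ (λ n → ℚ.≤-reflexive (sym (h n))))

  ≈-refl : ∀ {x} → x ≈ x
  ≈-refl = pointwise-≈ λ _ → refl

  ≈-sym : ∀ {x y} → x ≈ y → y ≈ x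
  ≈-sym p = ≼-antisym (≈⇒≽ p) (≈⇒≼ p)

  ≈-trans : ∀ {x y z} → x ≈ y → y ≈ z → x ≈ z
  ≈-trans p q = ≼-antisym (≼-trans (≈⇒≼ p) (≈⇒≼ q)) (≼-trans (≈⇒≽ q) (≈⇒≽ p))

  +-mono-≼ : ∀ {x y u v} → x ≼ y → u ≼ v → x + u ≼ y + v
  +-mono-≼ {x} {y} {u} {v} (wrap p) (wrap q) = wrap λ ε ε>0 →
    let δ = ½ ℚ.* ε; δ>0 = half-positive ε>0 in
    eventually-zip (λ {n} h k → begin-strict
      seq x n ℚ.+ seq u n                       <⟨ ℚ.+-mono-< h k ⟩
      (seq y n ℚ.+ δ) ℚ.+ (seq v n ℚ.+ δ)
        ≡⟨ solve 3 (λ y v δ → (y :+ δ) :+ (v :+ δ) := (y :+ v) :+ (δ :+ δ)) refl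
             (seq y n) (seq v n) δ ⟩
      (seq y n ℚ.+ seq v n) ℚ.+ (δ ℚ.+ δ)
        ≡⟨ cong ((seq y n ℚ.+ seq v n) ℚ.+_) (half+half ε) ⟩
      (seq y n ℚ.+ seq v n) ℚ.+ ε ∎) (p δ δ>0) (q δ δ>0)

  neg-anti-≼ : ∀ {x y} → x ≼ y → - y ≼ - x
  neg-anti-≼ {x} {y} (wrap p) = wrap λ ε ε>0 → eventually-map (λ {n} h → begin-strict
    ℚ.- seq y n
      ≡⟨ solve 2 (λ y x → :- y := x :+ (:- x :+ :- y)) refl (seq y n) (seq x n) ⟩
    seq x n ℚ.+ (ℚ.- seq x n ℚ.+ ℚ.- seq y n)
      <⟨ ℚ.+-monoˡ-< (ℚ.- seq x n ℚ.+ ℚ.- seq y n) h ⟩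
    (seq y n ℚ.+ ε) ℚ.+ (ℚ.- seq x n ℚ.+ ℚ.- seq y n)
      ≡⟨ solve 3 (λ y x ε → (y :+ ε) :+ (:- x :+ :- y) := :- x :+ ε) refl
           (seq y n) (seq x n) ε ⟩
    ℚ.- seq x n ℚ.+ ε ∎) (p ε ε>0)

  +-cong : ∀ {x y u v} → x ≈ y → u ≈ v → x + u ≈ y + v
  +-cong p q = ≼-antisym (+-mono-≼ (≈⇒≼ p) (≈⇒≼ q)) (+-mono-≼ (≈⇒≽ p) (≈⇒≽ q))

  -‿cong : ∀ {x y} → x ≈ y → - x ≈ - y
  -‿cong p = ≼-antisym (neg-anti-≼ (≈⇒≽ p)) (neg-anti-≼ (≈⇒≼ p))

  *-congˡ : ∀ {a x y} → x ≈ y → a * x ≈ a * y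
  *-congˡ {a} {x} {y} (wrap p) = wrap λ ε ε>0 →
    let B , B>0 , a<B = eventually-bounded a
        δ , δ>0 , Bδ≡ε = ℚ-divide B>0 ε>0
    in eventually-zip (λ {n} h k →
      let a′ = seq a n; x′ = seq x n; y′ = seq y n in begin-strict
      ℚ.∣ a′ ℚ.* x′ ℚ.- a′ ℚ.* y′ ∣
        ≡⟨ cong ℚ.∣_∣ (solve 3 (λ a x y → a :* x :- a :* y := a :* (x :- y)) refl a′ x′ y′) ⟩
      ℚ.∣ a′ ℚ.* (x′ ℚ.- y′) ∣
        ≡⟨ ℚ.∣p*q∣≡∣p∣*∣q∣ a′ (x′ ℚ.- y′) ⟩
      ℚ.∣ a′ ∣ ℚ.* ℚ.∣ x′ ℚ.- y′ ∣
        ≤⟨ ℚ.*-monoˡ-≤-nonNeg ℚ.∣ a′ ∣ {{ℚ.∣-∣-nonNeg a′}} (ℚ.<⇒≤ k) ⟩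
      ℚ.∣ a′ ∣ ℚ.* δ
        <⟨ ℚ.*-monoˡ-<-pos δ {{ℚ.positive δ>0}} h ⟩
      B ℚ.* δ
        ≡⟨ Bδ≡ε ⟩
      ε ∎) a<B (p δ δ>0)

  *-comm : ∀ x y → x * y ≈ y * x
  *-comm x y = pointwise-≈ λ n → ℚ.*-comm (seq x n) (seq y n)

  *-cong : ∀ {x y u v} → x ≈ y → u ≈ v → x * u ≈ y * v
  *-cong {x} {y} {u} {v} p q = ≈-trans (*-congˡ {x} {u} {v} q)
    (≈-trans (*-comm x v) (≈-trans (*-congˡ {v} {x} {y} p) (*-comm v y)))

  ∣∣-cong : ∀ {x y} → x ≈ y → ∣ x ∣ ≈ ∣ y ∣
  ∣∣-cong {x} {y} p = ≼-antisym (lemma p) (lemma (≈-sym p))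
    where
    lemma : ∀ {x y} → x ≈ y → ∣ x ∣ ≼ ∣ y ∣
    lemma {x} {y} (wrap p) = wrap λ ε ε>0 → eventually-map (λ {n} h → begin-strict
      ℚ.∣ seq x n ∣
        ≡⟨ cong ℚ.∣_∣ (p≡p-q+q (seq x n) (seq y n)) ⟩
      ℚ.∣ (seq x n ℚ.- seq y n) ℚ.+ seq y n ∣
        ≤⟨ ℚ.∣p+q∣≤∣p∣+∣q∣ (seq x n ℚ.- seq y n) (seq y n) ⟩
      ℚ.∣ seq x n ℚ.- seq y n ∣ ℚ.+ ℚ.∣ seq y n ∣
        <⟨ ℚ.+-monoˡ-< ℚ.∣ seq y n ∣ h ⟩
      ε ℚ.+ ℚ.∣ seq y n ∣
        ≡⟨ ℚ.+-comm ε ℚ.∣ seq y n ∣ ⟩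
      ℚ.∣ seq y n ∣ ℚ.+ ε ∎) (p ε ε>0)

ℝ-commutativeRing : CommutativeRing 0ℓ 0ℓ
ℝ-commutativeRing = record
  { Carrier = ℝ ; _≈_ = _≈_ ; _+_ = _+_ ; _*_ = _*_ ; -_ = -_ ; 0# = 0ℝ ; 1# = 1ℝ
  ; isCommutativeRing = record
    { isRing = record
      { +-isAbelianGroup = record
        { isGroup = record
          { isMonoid = record
            { isSemigroup = record
              { isMagma = record
                { isEquivalence = record { refl = ≈-refl ; sym = ≈-sym ; trans = ≈-trans }
                ; ∙-cong = +-cong }
              ; assoc = λ x y z → pointwise-≈ λ n → ℚ.+-assoc (seq x n) (seq y n) (seq z n) }
            ; identity = (λ x → pointwise-≈ λ n → ℚ.+-identityˡ (seq x n))
                       , (λ x → pointwise-≈ λ n → ℚ.+-identityʳ (seq x n)) }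
          ; inverse = (λ x → pointwise-≈ λ n → ℚ.+-inverseˡ (seq x n))
                    , (λ x → pointwise-≈ λ n → ℚ.+-inverseʳ (seq x n))
          ; ⁻¹-cong = -‿cong }
        ; comm = λ x y → pointwise-≈ λ n → ℚ.+-comm (seq x n) (seq y n) }
      ; *-cong = *-cong
      ; *-assoc = λ x y z → pointwise-≈ λ n → ℚ.*-assoc (seq x n) (seq y n) (seq z n)
      ; *-identity = (λ x → pointwise-≈ λ n → ℚ.*-identityˡ (seq x n))
                   , (λ x → pointwise-≈ λ n → ℚ.*-identityʳ (seq x n))
      ; distrib = (λ x y z → pointwise-≈ λ n → ℚ.*-distribˡ-+ (seq x n) (seq y n) (seq z n))
                , (λ x y z → pointwise-≈ λ n → ℚ.*-distribʳ-+ (seq x n) (seq y n) (seq z n)) }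
    ; *-comm = *-comm } }

≼-isPreorder : IsPreorder _≈_ _≼_
≼-isPreorder = record
  { isEquivalence = record { refl = ≈-refl ; sym = ≈-sym ; trans = ≈-trans }
  ; reflexive = ≈⇒≼ ; trans = ≼-trans }

module ≼-Reasoning = Relation.Binary.Reasoning.Base.Double ≼-isPreorder

-- Order, positivity and reciprocals of real numbers

module _ where
  open +-*-Solver using (solve; _:=_; _:+_; _:*_; _:-_; :-_; con)
  open ℚ.≤-Reasoning

  -- Nonnegativity is asked of the representing sequence, which is more than `0ℝ ≤ a`, so that
  -- rational inequalities can be multiplied term by term. Positive reals, absolute values and
  -- positive rationals all satisfy it.
  *-monoʳ-≼ : ∀ {a x y} → Eventually (λ n → 0ℚ ℚ.≤ seq a n) → x ≼ y → a * x ≼ a * y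
  *-monoʳ-≼ {a} {x} {y} a≥0 (wrap p) = wrap λ ε ε>0 →
    let B , B>0 , a<B = eventually-bounded a
        δ , δ>0 , Bδ≡ε = ℚ-divide B>0 ε>0
    in eventually-zip (λ {n} (h , k) l →
      let a′ = seq a n; x′ = seq x n; y′ = seq y n in begin-strict
      a′ ℚ.* x′                 ≤⟨ ℚ.*-monoˡ-≤-nonNeg a′ {{ℚ.nonNegative h}} (ℚ.<⇒≤ l) ⟩
      a′ ℚ.* (y′ ℚ.+ δ)         ≡⟨ ℚ.*-distribˡ-+ a′ y′ δ ⟩
      a′ ℚ.* y′ ℚ.+ a′ ℚ.* δ
        <⟨ ℚ.+-monoʳ-< (a′ ℚ.* y′) (ℚ.*-monoˡ-<-pos δ {{ℚ.positive δ>0}}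
             (ℚ.≤-<-trans (p≤∣p∣ a′) k)) ⟩
      a′ ℚ.* y′ ℚ.+ B ℚ.* δ     ≡⟨ cong (a′ ℚ.* y′ ℚ.+_) Bδ≡ε ⟩
      a′ ℚ.* y′ ℚ.+ ε           ∎) (eventually-zip _,_ a≥0 a<B) (p δ δ>0)

  positive-seq : ∀ {x} → 0ℝ < x →
                 ∃[ δ ] 0ℚ ℚ.< δ × Eventually (λ n → δ ℚ.< seq x n)
  positive-seq {x} (δ , δ>0 , h) = δ , δ>0 ,
    eventually-map (λ {n} → subst (ℚ._< seq x n) (ℚ.+-identityˡ δ)) h

  eventually-nonneg : ∀ {x} → 0ℝ < x → Eventually (λ n → 0ℚ ℚ.≤ seq x n)
  eventually-nonneg {x} x>0 with positive-seq {x} x>0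
  ... | δ , δ>0 , h = eventually-map (λ δ<x → ℚ.<⇒≤ (ℚ.<-trans δ>0 δ<x)) h

  *-pos : ∀ {x y} → 0ℝ < x → 0ℝ < y → 0ℝ < x * y
  *-pos {x} {y} x>0 y>0 =
    let δ , δ>0 , h = positive-seq {x} x>0
        η , η>0 , k = positive-seq {y} y>0
    in δ ℚ.* η , *-positive δ>0 η>0 , eventually-zip (λ {n} δ<x η<y → begin-strict
      0ℚ ℚ.+ δ ℚ.* η        ≡⟨ ℚ.+-identityˡ _ ⟩
      δ ℚ.* η               <⟨ ℚ.*-monoˡ-<-pos η {{ℚ.positive η>0}} δ<x ⟩
      seq x n ℚ.* η
        <⟨ ℚ.*-monoʳ-<-pos (seq x n) {{ℚ.positive (ℚ.<-trans δ>0 δ<x)}} η<y ⟩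
      seq x n ℚ.* seq y n   ∎) h k

  0<1 : 0ℝ < 1ℝ
  0<1 = ½ , ℚ.positive⁻¹ ½ , 0 , λ _ _ →
    subst (ℚ._< 1ℚ) (sym (ℚ.+-identityˡ ½)) (half< (ℚ.positive⁻¹ 1ℚ))

  ∏-pos : ∀ {n} (f : _) → (∀ i → 0ℝ < f i) → 0ℝ < ∏ {n} f
  ∏-pos {zero}  f h = 0<1
  ∏-pos {suc n} f h = *-pos {f fzero} {∏ (f ∘ fsuc)}
    (h fzero) (∏-pos (f ∘ fsuc) (h ∘ fsuc))

  x<y⇒0<y-x : ∀ {x y} → x < y → 0ℝ < y - x
  x<y⇒0<y-x {x} {y} (δ , δ>0 , h) = δ , δ>0 , eventually-map (λ {n} k → begin-strict
    0ℚ ℚ.+ δ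
      ≡⟨ solve 2 (λ x δ → con 0ℚ :+ δ := (x :+ δ) :- x) refl (seq x n) δ ⟩
    (seq x n ℚ.+ δ) ℚ.- seq x n   <⟨ ℚ.+-monoˡ-< (ℚ.- seq x n) k ⟩
    seq y n ℚ.- seq x n           ∎) h

  ≼-<-trans : ∀ {x y z} → x ≼ y → y < z → x < z
  ≼-<-trans {x} {y} {z} (wrap p) (ε , ε>0 , h) =
    -- Half of the gap ε absorbs the slack of `_≼_`; the other half is the new gap.
    let δ = ½ ℚ.* ε; δ>0 = half-positive ε>0 in
    δ , δ>0 , eventually-zip (λ {n} k l → begin-strict
      seq x n ℚ.+ δ             <⟨ ℚ.+-monoˡ-< δ k ⟩
      (seq y n ℚ.+ δ) ℚ.+ δ     ≡⟨ ℚ.+-assoc (seq y n) δ δ ⟩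
      seq y n ℚ.+ (δ ℚ.+ δ)     ≡⟨ cong (seq y n ℚ.+_) (half+half ε) ⟩
      seq y n ℚ.+ ε             <⟨ l ⟩
      seq z n                   ∎) (p δ δ>0) h

  <⇒≼ : ∀ {x y} → x < y → x ≼ y
  <⇒≼ {x} {y} (ε , ε>0 , h) = eventually-≼ (eventually-map (λ {n} k →
    ℚ.<⇒≤ (ℚ.<-trans (p<p+q (seq x n) ε>0) k)) h)

  fromℚ-positive : ∀ {q} → 0ℚ ℚ.< q → 0ℝ < fromℚ q
  fromℚ-positive {q} q>0 = ½ ℚ.* q , half-positive q>0 , 0 , λ _ _ →
    subst (ℚ._< q) (sym (ℚ.+-identityˡ _)) (half< q>0)

  fromℚ-below : ∀ {x} → 0ℝ < x → ∃[ q ] 0ℚ ℚ.< q × fromℚ q < x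
  fromℚ-below {x} x>0 with positive-seq {x} x>0
  ... | q , q>0 , h = ½ ℚ.* q , half-positive q>0 , ½ ℚ.* q , half-positive q>0 ,
    eventually-map (λ {n} → subst (ℚ._< seq x n) (sym (half+half q))) h

  -- Dropping the terms before N leaves the limit unchanged and makes every
  -- remaining term exceed δ, so that each has a reciprocal.
  reciprocal : ∀ {x} → 0ℝ < x → ∃[ z ] x * z ≈ 1ℝ
  reciprocal {x} x>0 with positive-seq {x} x>0
  ... | δ , δ>0 , N , δ<x = mkℝ z z-cauchy , wrap xz≃1
    where
    s : ℕ → ℚ
    s n = seq x (n ℕ.+ N)
    δ<s : ∀ n → δ ℚ.< s n
    δ<s n = δ<x (n ℕ.+ N) (ℕ.m≤n+m N n)
    s>0 : ∀ n → 0ℚ ℚ.< s n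
    s>0 n = ℚ.<-trans δ>0 (δ<s n)
    z : ℕ → ℚ
    z n = proj₁ (ℚ-reciprocal (s>0 n))
    z>0 : ∀ n → 0ℚ ℚ.< z n
    z>0 n = proj₁ (proj₂ (ℚ-reciprocal (s>0 n)))
    sz≡1 : ∀ n → s n ℚ.* z n ≡ 1ℚ
    sz≡1 n = proj₂ (proj₂ (ℚ-reciprocal (s>0 n)))
    e : ℚ
    e = proj₁ (ℚ-reciprocal δ>0)
    e>0 : 0ℚ ℚ.< e
    e>0 = proj₁ (proj₂ (ℚ-reciprocal δ>0))
    δe≡1 : δ ℚ.* e ≡ 1ℚ
    δe≡1 = proj₂ (proj₂ (ℚ-reciprocal δ>0))
    ∣z∣≤e : ∀ n → ℚ.∣ z n ∣ ℚ.≤ e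
    ∣z∣≤e n = begin
      ℚ.∣ z n ∣               ≡⟨ ℚ.0≤p⇒∣p∣≡p (ℚ.<⇒≤ (z>0 n)) ⟩
      z n                     ≡⟨ sym (ℚ.*-identityˡ (z n)) ⟩
      1ℚ ℚ.* z n              ≡⟨ cong (ℚ._* z n) (sym δe≡1) ⟩
      (δ ℚ.* e) ℚ.* z n
        ≡⟨ solve 3 (λ δ e z → (δ :* e) :* z := (e :* z) :* δ) refl δ e (z n) ⟩
      (e ℚ.* z n) ℚ.* δ
        ≤⟨ ℚ.*-monoˡ-≤-nonNeg (e ℚ.* z n)
             {{ℚ.nonNegative (ℚ.<⇒≤ (*-positive e>0 (z>0 n)))}} (ℚ.<⇒≤ (δ<s n)) ⟩
      (e ℚ.* z n) ℚ.* s n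
        ≡⟨ solve 3 (λ e z s → (e :* z) :* s := e :* (s :* z)) refl e (z n) (s n) ⟩
      e ℚ.* (s n ℚ.* z n)     ≡⟨ cong (e ℚ.*_) (sz≡1 n) ⟩
      e ℚ.* 1ℚ                ≡⟨ ℚ.*-identityʳ e ⟩
      e                       ∎
    ∣pz∣<ε : ∀ p n {ε η} → e ℚ.* η ≡ ε → ℚ.∣ p ∣ ℚ.< η → ℚ.∣ p ℚ.* z n ∣ ℚ.< ε
    ∣pz∣<ε p n {ε} {η} eη≡ε h = begin-strict
      ℚ.∣ p ℚ.* z n ∣         ≡⟨ ℚ.∣p*q∣≡∣p∣*∣q∣ p (z n) ⟩
      ℚ.∣ p ∣ ℚ.* ℚ.∣ z n ∣   ≤⟨ ℚ.*-monoˡ-≤-nonNeg ℚ.∣ p ∣ {{ℚ.∣-∣-nonNeg p}} (∣z∣≤e n) ⟩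
      ℚ.∣ p ∣ ℚ.* e           <⟨ ℚ.*-monoˡ-<-pos e {{ℚ.positive e>0}} h ⟩
      η ℚ.* e                 ≡⟨ ℚ.*-comm η e ⟩
      e ℚ.* η                 ≡⟨ eη≡ε ⟩
      ε                       ∎
    z-cauchy : IsCauchy z
    z-cauchy ε ε>0 =
      -- The difference z m - z n carries two factors z, each of size at most e, so the tolerance is
      -- divided by e twice.
      let η , η>0 , eη≡ε = ℚ-divide e>0 ε>0
          θ , θ>0 , eθ≡η = ℚ-divide e>0 η>0
          M , h = cauchy x θ θ>0
      in M , λ m n M≤m M≤n → subst (λ t → ℚ.∣ t ∣ ℚ.< ε) (sym (diff m n))
        (∣pz∣<ε ((s n ℚ.- s m) ℚ.* z m) n eη≡ε
          (∣pz∣<ε (s n ℚ.- s m) m eθ≡η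
            (h (n ℕ.+ N) (m ℕ.+ N) (ℕ.≤-trans M≤n (ℕ.m≤m+n n N))
                                   (ℕ.≤-trans M≤m (ℕ.m≤m+n m N)))))
      where
      diff : ∀ m n → z m ℚ.- z n ≡ ((s n ℚ.- s m) ℚ.* z m) ℚ.* z n
      diff m n = begin-equality
        z m ℚ.- z n
          ≡⟨ solve 2 (λ z w → z :- w := con 1ℚ :* z :- con 1ℚ :* w) refl (z m) (z n) ⟩
        1ℚ ℚ.* z m ℚ.- 1ℚ ℚ.* z n
          ≡⟨ cong₂ (λ t u → t ℚ.* z m ℚ.- u ℚ.* z n) (sym (sz≡1 n)) (sym (sz≡1 m)) ⟩
        (s n ℚ.* z n) ℚ.* z m ℚ.- (s m ℚ.* z m) ℚ.* z n
          ≡⟨ solve 4 (λ s w t z → (s :* w) :* z :- (t :* z) :* w := ((s :- t) :* z) :* w)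
               refl (s n) (z n) (s m) (z m) ⟩
        ((s n ℚ.- s m) ℚ.* z m) ℚ.* z n ∎
    xz≃1 : x * mkℝ z z-cauchy ≃ 1ℝ
    xz≃1 ε ε>0 =
      let η , η>0 , eη≡ε = ℚ-divide e>0 ε>0
          M , h = cauchy x η η>0
      in M , λ n M≤n → subst (λ t → ℚ.∣ t ∣ ℚ.< ε) (sym (diff n))
        (∣pz∣<ε (seq x n ℚ.- s n) n eη≡ε
          (h n (n ℕ.+ N) M≤n (ℕ.≤-trans M≤n (ℕ.m≤m+n n N))))
      where
      diff : ∀ n → seq x n ℚ.* z n ℚ.- 1ℚ ≡ (seq x n ℚ.- s n) ℚ.* z n
      diff n = trans (cong (λ t → seq x n ℚ.* z n ℚ.- t) (sym (sz≡1 n)))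
        (solve 3 (λ x z s → x :* z :- s :* z := (x :- s) :* z) refl (seq x n) (z n) (s n))

  -- Rational bounds, the Archimedean property and geometric decay

  fromℚ-above : ∀ x → ∃[ B ] 0ℚ ℚ.< B × x ≼ fromℚ B
  fromℚ-above x =
    let B , B>0 , h = eventually-bounded x
    in B , B>0 , eventually-≼ {x} {fromℚ B}
      (eventually-map (λ {n} k → ℚ.≤-trans (p≤∣p∣ (seq x n)) (ℚ.<⇒≤ k)) h)

  -- A recursion over p indices leaves the first p terms free; `Decay` starts from this common bound
  -- for them.
  initial-bound : ∀ p (d : ℕ → ℝ) → ∃[ B ] 0ℚ ℚ.< B × (∀ m → m ℕ.< p → d m ≼ fromℚ B)
  initial-bound zero    d = 1ℚ , ℚ.positive⁻¹ 1ℚ , λ _ ()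
  initial-bound (suc p) d =
    let B , B>0 , h = initial-bound p d
        C , C>0 , k = fromℚ-above (d p)
    in B ℚ.⊔ C , ℚ.<-≤-trans B>0 (ℚ.p≤p⊔q B C) , λ m m<1+p →
      [ (λ m<p → ≼-trans (h m m<p) (pointwise-≼ λ _ → ℚ.p≤p⊔q B C))
      , (λ m≡p → ≼-trans (subst (λ m → d m ≼ fromℚ C) (sym m≡p) k)
                         (pointwise-≼ λ _ → ℚ.p≤q⊔p B C))
      ]′ (ℕ.m<1+n⇒m<n∨m≡n m<1+p)

  -- Defined by recursion so that the induction step of `bernoulli` unfolds to 1 + K.
  ℕ⇒ℚ : ℕ → ℚ
  ℕ⇒ℚ zero    = 0ℚ
  ℕ⇒ℚ (suc n) = 1ℚ ℚ.+ ℕ⇒ℚ n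

  ℕ⇒ℚ-nonneg : ∀ n → 0ℚ ℚ.≤ ℕ⇒ℚ n
  ℕ⇒ℚ-nonneg zero    = ℚ.≤-refl
  ℕ⇒ℚ-nonneg (suc n) = ℚ.+-mono-≤ (ℚ.<⇒≤ (ℚ.positive⁻¹ 1ℚ)) (ℕ⇒ℚ-nonneg n)

  toℚᵘ-ℕ⇒ℚ : ∀ n → ℚ.toℚᵘ (ℕ⇒ℚ n) ℚᵘ.≃ ℚᵘ.mkℚᵘ (ℤ.+ n) 0
  toℚᵘ-ℕ⇒ℚ zero    = ℚᵘ.≃-refl
  toℚᵘ-ℕ⇒ℚ (suc n) = ℚᵘ.≃-trans (ℚ.toℚᵘ-homo-+ 1ℚ (ℕ⇒ℚ n))
    (ℚᵘ.≃-trans (ℚᵘ.+-congʳ (ℚ.toℚᵘ 1ℚ) (toℚᵘ-ℕ⇒ℚ n))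
      (ℚᵘ.≃-reflexive (cong (λ k → ℚᵘ.mkℚᵘ (ℤ.1ℤ ℤ.+ k) 0) (ℤ.*-identityʳ (ℤ.+ n)))))

  -- The denominator is at least 1, so the absolute value of the numerator is large enough.
  archimedean : ∀ q → ∃[ n ] q ℚ.≤ ℕ⇒ℚ n
  archimedean q@(ℚ.mkℚ m d _) = ℤ.∣ m ∣ , ℚ.toℚᵘ-cancel-≤
    (ℚᵘ.≤-respʳ-≃ (ℚᵘ.≃-sym (toℚᵘ-ℕ⇒ℚ ℤ.∣ m ∣)) (ℚᵘ.*≤* (numerator m)))
    where
    numerator : ∀ m → m ℤ.* ℤ.1ℤ ℤ.≤ ℤ.+ ℤ.∣ m ∣ ℤ.* ℤ.+ suc d
    numerator (ℤ.+ k) = ℤ.≤-trans (ℤ.≤-reflexive (sym (ℤ.pos-* k 1)))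
      (ℤ.≤-trans (ℤ.+≤+ (ℕ.*-monoʳ-≤ k (ℕ.s≤s ℕ.z≤n))) (ℤ.≤-reflexive (ℤ.pos-* k (suc d))))
    numerator (ℤ.-[1+ k ]) = ℤ.-≤+

  _^_ : ℚ → ℕ → ℚ
  q ^ zero  = 1ℚ
  q ^ suc k = q ℚ.* q ^ k

  ^-positive : ∀ {q} → 0ℚ ℚ.< q → ∀ k → 0ℚ ℚ.< q ^ k
  ^-positive q>0 zero    = ℚ.positive⁻¹ 1ℚ
  ^-positive q>0 (suc k) = *-positive q>0 (^-positive q>0 k)

  module _ {η} (η>0 : 0ℚ ℚ.< η) (η<1 : 0ℚ ℚ.< 1ℚ ℚ.- η) where

    -- Multiplying 1 + (k + 1)η by 1 - η gives at most 1 + kη. This is Bernoulli's inequality turned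
    -- into the bound 1/(1 + kη) for a power of 1 - η, written without division.
    bernoulli : ∀ k → (1ℚ ℚ.- η) ^ k ℚ.* (1ℚ ℚ.+ ℕ⇒ℚ k ℚ.* η) ℚ.≤ 1ℚ
    bernoulli zero    = ℚ.≤-reflexive
      (solve 1 (λ η → con 1ℚ :* (con 1ℚ :+ con 0ℚ :* η) := con 1ℚ) refl η)
    bernoulli (suc k) = begin
      ((1ℚ ℚ.- η) ℚ.* Q) ℚ.* (1ℚ ℚ.+ (1ℚ ℚ.+ K) ℚ.* η)
        -- The added term completes an identity: (1 - η)(1 + (1 + K)η) + (1 + K)η² = 1 + Kη.
        ≤⟨ ℚ.<⇒≤ (p<p+q (((1ℚ ℚ.- η) ℚ.* Q) ℚ.* (1ℚ ℚ.+ (1ℚ ℚ.+ K) ℚ.* η))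
             (*-positive (*-positive Q>0 K+1>0) (*-positive η>0 η>0))) ⟩
      ((1ℚ ℚ.- η) ℚ.* Q) ℚ.* (1ℚ ℚ.+ (1ℚ ℚ.+ K) ℚ.* η) ℚ.+ (Q ℚ.* (1ℚ ℚ.+ K)) ℚ.* (η ℚ.* η)
        ≡⟨ solve 3 (λ η Q K →
             ((con 1ℚ :- η) :* Q) :* (con 1ℚ :+ (con 1ℚ :+ K) :* η)
               :+ (Q :* (con 1ℚ :+ K)) :* (η :* η)
             := Q :* (con 1ℚ :+ K :* η)) refl η Q K ⟩
      Q ℚ.* (1ℚ ℚ.+ K ℚ.* η)
        ≤⟨ bernoulli k ⟩
      1ℚ ∎
      where
      Q = (1ℚ ℚ.- η) ^ k
      K = ℕ⇒ℚ k
      Q>0 : 0ℚ ℚ.< Q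
      Q>0 = ^-positive η<1 k
      K+1>0 : 0ℚ ℚ.< 1ℚ ℚ.+ K
      K+1>0 = ℚ.+-mono-<-≤ (ℚ.positive⁻¹ 1ℚ) (ℕ⇒ℚ-nonneg k)

    power-decay : ∀ B {ε} → 0ℚ ℚ.< ε → ∃[ k ] (1ℚ ℚ.- η) ^ k ℚ.* B ℚ.≤ ε
    -- Here r = 1/(ηε), so k is at least B/(ηε), and then Q B ≤ Q η ε K ≤ ε Q (1 + Kη) ≤ ε.
    power-decay B {ε} ε>0 with ℚ-reciprocal (*-positive η>0 ε>0)
    ... | r , r>0 , ηεr≡1 with archimedean (B ℚ.* r)
    ... | k , Br≤k = k , (begin
      Q ℚ.* B
        ≡⟨ cong (Q ℚ.*_) (trans (sym (ℚ.*-identityʳ B)) (cong (B ℚ.*_) (sym ηεr≡1))) ⟩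
      Q ℚ.* (B ℚ.* ((η ℚ.* ε) ℚ.* r))
        ≡⟨ solve 5 (λ Q B η ε r → Q :* (B :* ((η :* ε) :* r)) := ((Q :* η) :* ε) :* (B :* r))
             refl Q B η ε r ⟩
      ((Q ℚ.* η) ℚ.* ε) ℚ.* (B ℚ.* r)
        ≤⟨ ℚ.*-monoˡ-≤-nonNeg ((Q ℚ.* η) ℚ.* ε) {{ℚ.nonNegative
             (ℚ.<⇒≤ (*-positive (*-positive Q>0 η>0) ε>0))}} Br≤k ⟩
      ((Q ℚ.* η) ℚ.* ε) ℚ.* K
        ≤⟨ ℚ.<⇒≤ (p<p+q (((Q ℚ.* η) ℚ.* ε) ℚ.* K) (*-positive ε>0 Q>0)) ⟩
      ((Q ℚ.* η) ℚ.* ε) ℚ.* K ℚ.+ ε ℚ.* Q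
        ≡⟨ solve 4 (λ Q η ε K → ((Q :* η) :* ε) :* K :+ ε :* Q
                              := ε :* (Q :* (con 1ℚ :+ K :* η))) refl Q η ε K ⟩
      ε ℚ.* (Q ℚ.* (1ℚ ℚ.+ K ℚ.* η))
        ≤⟨ ℚ.*-monoˡ-≤-nonNeg ε {{ℚ.nonNegative (ℚ.<⇒≤ ε>0)}} (bernoulli k) ⟩
      ε ℚ.* 1ℚ
        ≡⟨ ℚ.*-identityʳ ε ⟩
      ε ∎)
      where
      Q = (1ℚ ℚ.- η) ^ k
      K = ℕ⇒ℚ k
      Q>0 : 0ℚ ℚ.< Q
      Q>0 = ^-positive η<1 k

-- Limits

infix 4 _⟶_

-- Rational tolerances suffice because a positive rational lies below every positive real. The weak
-- bound keeps limit arguments inside the preorder `_≼_`.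
_⟶_ : (ℕ → ℝ) → ℝ → Set
f ⟶ s = ∀ q → 0ℚ ℚ.< q → Eventually (λ n → ∣ f n - s ∣ ≼ fromℚ q)

module _ where
  open +-*-Solver using (solve; _:=_; _:+_; _:*_; _:-_; :-_; con)
  open ≼-Reasoning

  HasSum⇒⟶ : ∀ {f s} → HasSum f s → (λ n → ∑ {n} (f ∘ toℕ)) ⟶ s
  HasSum⇒⟶ {f} {s} h q q>0 = eventually-map
    (λ {n} → <⇒≼ {∣ ∑ {n} (f ∘ toℕ) - s ∣} {fromℚ q}) (h (fromℚ q) (fromℚ-positive q>0))

  ⟶⇒HasSum : ∀ {f s} → (λ n → ∑ {n} (f ∘ toℕ)) ⟶ s → HasSum f s
  ⟶⇒HasSum {f} {s} h ε ε>0 =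
    let q , q>0 , q<ε = fromℚ-below {ε} ε>0 in
    eventually-map (λ {n} k → ≼-<-trans {∣ ∑ {n} (f ∘ toℕ) - s ∣} {fromℚ q} {ε} k q<ε) (h q q>0)

  ∣x-y∣≈∣y-x∣ : ∀ x y → ∣ x - y ∣ ≈ ∣ y - x ∣
  ∣x-y∣≈∣y-x∣ x y = pointwise-≈ λ n → ∣p-q∣≡∣q-p∣ (seq x n) (seq y n)

  ∣x-y∣≼z⇒x≼y+z : ∀ {x y z} → ∣ x - y ∣ ≼ z → x ≼ y + z
  ∣x-y∣≼z⇒x≼y+z {x} {y} {z} h = begin
    x               ≈⟨ pointwise-≈ (λ n →
                         solve 2 (λ x y → x := y :+ (x :- y)) refl (seq x n) (seq y n)) ⟩
    y + (x - y)     ≲⟨ +-mono-≼ ≼-refl (pointwise-≼ λ n → p≤∣p∣ (seq x n ℚ.- seq y n)) ⟩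
    y + ∣ x - y ∣   ≲⟨ +-mono-≼ ≼-refl h ⟩
    y + z           ∎

  ≼-fromℚ-closed : ∀ {x y} → (∀ q → 0ℚ ℚ.< q → x ≼ y + fromℚ q) → x ≼ y
  ≼-fromℚ-closed {x} {y} h = wrap λ ε ε>0 →
    let δ = ½ ℚ.* ε; δ>0 = half-positive ε>0 in
    eventually-map (λ {n} k → subst (seq x n ℚ.<_)
      (trans (ℚ.+-assoc (seq y n) δ δ) (cong (seq y n ℚ.+_) (half+half ε))) k)
      (≼⇒≤ (h δ δ>0) δ δ>0)

  ⟶-mono : ∀ {f g s t} → f ⟶ s → g ⟶ t → (∀ n → f n ≼ g n) → s ≼ t
  ⟶-mono {f} {g} {s} {t} f⟶s g⟶t f≼g = ≼-fromℚ-closed λ q q>0 →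
    let δ = ½ ℚ.* q; δ>0 = half-positive q>0
        N , bound = eventually-zip (λ {n} h k → begin
          s                             ≲⟨ ∣x-y∣≼z⇒x≼y+z (≼-trans (≈⇒≼ (∣x-y∣≈∣y-x∣ s (f n))) h) ⟩
          f n + fromℚ δ                 ≲⟨ +-mono-≼ (f≼g n) ≼-refl ⟩
          g n + fromℚ δ                 ≲⟨ +-mono-≼ (∣x-y∣≼z⇒x≼y+z k) ≼-refl ⟩
          (t + fromℚ δ) + fromℚ δ
            ≈⟨ pointwise-≈ (λ n → trans (ℚ.+-assoc (seq t n) δ δ)
                                        (cong (seq t n ℚ.+_) (half+half q))) ⟩
          t + fromℚ q                   ∎) (f⟶s δ δ>0) (g⟶t δ δ>0)
    -- The inequality between s and t + q mentions no index, so one late index proves it.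
    in bound N ℕ.≤-refl

  ⟶-cong : ∀ {f g s} → (∀ n → f n ≈ g n) → f ⟶ s → g ⟶ s
  ⟶-cong f≈g f⟶s q q>0 = eventually-map
    (λ {n} → ≼-trans (≈⇒≼ (∣∣-cong (+-cong (≈-sym (f≈g n)) ≈-refl)))) (f⟶s q q>0)

  ⟶-shift : ∀ {f s} p → (λ n → f (p ℕ.+ n)) ⟶ s → f ⟶ s
  ⟶-shift {f} {s} p h q q>0 =
    let N , k = h q q>0 in p ℕ.+ N , λ n p+N≤n →
      subst (λ m → ∣ f m - s ∣ ≼ fromℚ q) (ℕ.m+[n∸m]≡n (ℕ.m+n≤o⇒m≤o p p+N≤n))
        (k (n ℕ.∸ p) (subst (ℕ._≤ n ℕ.∸ p) (ℕ.m+n∸m≡n p N) (ℕ.∸-monoˡ-≤ p p+N≤n)))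

  ∣∣-nonneg : ∀ x → Eventually (λ n → 0ℚ ℚ.≤ seq ∣ x ∣ n)
  ∣∣-nonneg x = 0 , λ n _ → ℚ.0≤∣p∣ (seq x n)

  *-mono-∣∣ : ∀ {x y} z → x ≼ y → x * ∣ z ∣ ≼ y * ∣ z ∣
  *-mono-∣∣ {x} {y} z x≼y = begin
    x * ∣ z ∣   ≈⟨ *-comm x ∣ z ∣ ⟩
    ∣ z ∣ * x   ≲⟨ *-monoʳ-≼ (∣∣-nonneg z) x≼y ⟩
    ∣ z ∣ * y   ≈⟨ *-comm ∣ z ∣ y ⟩
    y * ∣ z ∣   ∎

  ∣affine-difference∣ : ∀ a b x y → ∣ (a + b * x) - (a + b * y) ∣ ≈ ∣ b ∣ * ∣ x - y ∣
  ∣affine-difference∣ a b x y = pointwise-≈ λ n → trans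
    (cong ℚ.∣_∣ (solve 4 (λ a b x y → (a :+ b :* x) :- (a :+ b :* y) := b :* (x :- y)) refl
      (seq a n) (seq b n) (seq x n) (seq y n)))
    (ℚ.∣p*q∣≡∣p∣*∣q∣ (seq b n) (seq x n ℚ.- seq y n))

  fromℚ-*-mono : ∀ {p} {x q} → 0ℚ ℚ.< p → x ≼ fromℚ q → fromℚ p * x ≼ fromℚ (p ℚ.* q)
  fromℚ-*-mono p>0 h = ≼-trans (*-monoʳ-≼ (0 , λ _ _ → ℚ.<⇒≤ p>0) h) (pointwise-≼ λ _ → ℚ.≤-refl)

  ⟶-affine : ∀ {f s} a b → f ⟶ s → (λ n → a + b * f n) ⟶ a + b * s
  ⟶-affine {f} {s} a b f⟶s q q>0 =
    let B , B>0 , ∣b∣≼B = fromℚ-above ∣ b ∣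
        δ , δ>0 , Bδ≡q = ℚ-divide B>0 q>0
    in eventually-map (λ {n} h → begin
      ∣ (a + b * f n) - (a + b * s) ∣   ≈⟨ ∣affine-difference∣ a b (f n) s ⟩
      ∣ b ∣ * ∣ f n - s ∣               ≲⟨ *-mono-∣∣ (f n - s) ∣b∣≼B ⟩
      fromℚ B * ∣ f n - s ∣             ≲⟨ fromℚ-*-mono B>0 h ⟩
      fromℚ (B ℚ.* δ)                   ≈⟨ pointwise-≈ (λ _ → Bδ≡q) ⟩
      fromℚ q                           ∎) (f⟶s δ δ>0)

  -- Here d will be the distance of partial sums to their limit. Only indices p apart are related:
  -- the first p values need a common bound, and k rounds then contribute the factor (1 - η)^k.
  module Decay {d : ℕ → ℝ} {η p} (η>0 : 0ℚ ℚ.< η) (η<1 : 0ℚ ℚ.< 1ℚ ℚ.- η)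
    (p>0 : 0 ℕ.< p) (d-step : ∀ n → d (p ℕ.+ n) ≼ fromℚ (1ℚ ℚ.- η) * d n) where

    B : ℚ
    B = proj₁ (initial-bound p d)

    B>0 : 0ℚ ℚ.< B
    B>0 = proj₁ (proj₂ (initial-bound p d))

    d-step-bound : ∀ {n C} → p ℕ.≤ n → d (n ℕ.∸ p) ≼ fromℚ C → d n ≼ fromℚ ((1ℚ ℚ.- η) ℚ.* C)
    d-step-bound {n} p≤n h = subst (λ m → d m ≼ _) (ℕ.m+[n∸m]≡n p≤n)
      (≼-trans (d-step (n ℕ.∸ p)) (fromℚ-*-mono η<1 h))

    d≼B : ∀ n → d n ≼ fromℚ B
    d≼B = <-rec _ λ n rec → [ proj₂ (proj₂ (initial-bound p d)) n , later n rec ]′ (ℕ.<-≤-connex n p)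
      where
      shrink : (1ℚ ℚ.- η) ℚ.* B ℚ.≤ B
      shrink = ℚ.≤-trans (ℚ.<⇒≤ (p<p+q _ (*-positive η>0 B>0)))
        (ℚ.≤-reflexive (solve 2 (λ η B → (con 1ℚ :- η) :* B :+ η :* B := B) refl η B))
      later : ∀ n → (∀ {m} → m ℕ.< n → d m ≼ fromℚ B) → p ℕ.≤ n → d n ≼ fromℚ B
      later n rec p≤n = ≼-trans
        (d-step-bound p≤n (rec (ℕ.∸-monoʳ-< p>0 p≤n))) (pointwise-≼ λ _ → shrink)

    d≼power : ∀ k n → k ℕ.* p ℕ.≤ n → d n ≼ fromℚ ((1ℚ ℚ.- η) ^ k ℚ.* B)
    d≼power zero    n _ = ≼-trans (d≼B n) (pointwise-≼ λ _ → ℚ.≤-reflexive (sym (ℚ.*-identityˡ B)))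
    d≼power (suc k) n h = ≼-trans
      (d-step-bound (ℕ.m+n≤o⇒m≤o p h) (d≼power k (n ℕ.∸ p)
        (subst (ℕ._≤ n ℕ.∸ p) (ℕ.m+n∸m≡n p (k ℕ.* p)) (ℕ.∸-monoˡ-≤ p h))))
      (pointwise-≼ λ _ → ℚ.≤-reflexive (sym (ℚ.*-assoc (1ℚ ℚ.- η) ((1ℚ ℚ.- η) ^ k) B)))

    d-vanishes : ∀ ε → 0ℚ ℚ.< ε → Eventually (λ n → d n ≼ fromℚ ε)
    d-vanishes ε ε>0 =
      let k , small = power-decay η>0 η<1 B ε>0
      in k ℕ.* p , λ n kp≤n → ≼-trans (d≼power k n kp≤n) (pointwise-≼ λ _ → small)

  -- The margin of `w < 1ℝ` is a rational η with w eventually below 1 - η. As w is eventually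
  -- positive, its absolute value obeys the same bound and 1 - η is positive.
  contraction-factor : ∀ {w} → 0ℝ < w → w < 1ℝ →
    ∃[ η ] 0ℚ ℚ.< η × 0ℚ ℚ.< 1ℚ ℚ.- η × ∣ w ∣ ≼ fromℚ (1ℚ ℚ.- η)
  contraction-factor {w} w>0 (η , η>0 , w+η<1) =
    let δ , δ>0 , δ<w = positive-seq {w} w>0
        N , h = eventually-zip {R = λ n → 0ℚ ℚ.< seq w n × seq w n ℚ.< 1ℚ ℚ.- η}
          (λ {n} k l → ℚ.<-trans δ>0 k , subst (ℚ._< 1ℚ ℚ.- η)
            (solve 2 (λ w η → (w :+ η) :- η := w) refl (seq w n) η) (ℚ.+-monoˡ-< (ℚ.- η) l))
          δ<w w+η<1
    in η , η>0 , ℚ.<-trans (proj₁ (h N ℕ.≤-refl)) (proj₂ (h N ℕ.≤-refl)) ,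
       eventually-≼ {∣ w ∣} {fromℚ (1ℚ ℚ.- η)} (N , λ n N≤n → ℚ.≤-trans
         (ℚ.≤-reflexive (ℚ.0≤p⇒∣p∣≡p (ℚ.<⇒≤ (proj₁ (h n N≤n))))) (ℚ.<⇒≤ (proj₂ (h n N≤n))))

  -- Banach's argument: f and the constant τ obey the same affine recursion, so a cancels in their
  -- difference and w multiplies the error once every p steps.
  ⟶-fixpoint : ∀ {f a w τ p} → 0ℝ < w → w < 1ℝ → 0 ℕ.< p →
               (∀ n → f (p ℕ.+ n) ≈ a + w * f n) → a + w * τ ≈ τ → f ⟶ τ
  ⟶-fixpoint {f} {a} {w} {τ} {p} w>0 w<1 p>0 f-step τ-fix =
    let η , η>0 , η<1 , ∣w∣≼1-η = contraction-factor {w} w>0 w<1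
    in Decay.d-vanishes {λ n → ∣ f n - τ ∣} {η} {p} η>0 η<1 p>0 λ n → begin
      ∣ f (p ℕ.+ n) - τ ∣                ≈⟨ ∣∣-cong (+-cong (f-step n) (-‿cong (≈-sym τ-fix))) ⟩
      ∣ (a + w * f n) - (a + w * τ) ∣    ≈⟨ ∣affine-difference∣ a w (f n) τ ⟩
      ∣ w ∣ * ∣ f n - τ ∣                ≲⟨ *-mono-∣∣ (f n - τ) ∣w∣≼1-η ⟩
      fromℚ (1ℚ ℚ.- η) * ∣ f n - τ ∣     ∎

-- Series, affine functions and polyhedra

module ℝ-Ring = CommutativeRing ℝ-commutativeRing
module Sum = SemiringSum ℝ-Ring.semiring

∑-cong : ∀ {n} {f g : Vector ℝ n} → (∀ i → f i ≈ g i) → ∑ f ≈ ∑ g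
∑-cong = Sum.sum-cong-≋

∏-cong : ∀ {n} {f g : Vector ℝ n} → (∀ i → f i ≈ g i) → ∏ f ≈ ∏ g
∏-cong {zero}  f≈g = ≈-refl
∏-cong {suc n} f≈g = *-cong (f≈g fzero) (∏-cong (f≈g ∘ fsuc))

∑-mono : ∀ {n} {f g : Vector ℝ n} → (∀ i → f i ≼ g i) → ∑ f ≼ ∑ g
∑-mono {zero}  f≼g = ≼-refl
∑-mono {suc n} f≼g = +-mono-≼ (f≼g fzero) (∑-mono (f≼g ∘ fsuc))

module _ where
  open +-*-Solver using (solve; _:=_; _:+_; _:*_; _:-_; :-_; con)
  open ≼-Reasoning

  -- With g the edge weights and h the values x_v + c_e, this is the general term of Σ(W). Sequences
  -- in place of walks allow tails to be formed by shifting indices.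
  discounted : (g h : ℕ → ℝ) → ℕ → ℝ
  discounted g h k = ∏ {k} (g ∘ toℕ) * h k

  partialSum : (g h : ℕ → ℝ) → ℕ → ℝ
  partialSum g h n = ∑ {n} (discounted g h ∘ toℕ)

  partialSum-suc : ∀ g h n →
    partialSum g h (suc n) ≈ h 0 + g 0 * partialSum (g ∘ suc) (h ∘ suc) n
  partialSum-suc g h n = +-cong (ℝ-Ring.*-identityˡ (h 0)) (≈-trans
    (∑-cong {n} λ i → ℝ-Ring.*-assoc (g 0) (∏ {toℕ i} (g ∘ suc ∘ toℕ)) (h (suc (toℕ i))))
    (≈-sym (Sum.*-distribˡ-sum {n} (g 0) (discounted (g ∘ suc) (h ∘ suc) ∘ toℕ))))

  -- Cutting a walk after p edges discounts the rest by the weight of these edges. This peels off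
  -- both the stem and one round of the cycle.
  partialSum-+ : ∀ g h p n → partialSum g h (p ℕ.+ n) ≈
    partialSum g h p +
      ∏ {p} (g ∘ toℕ) * partialSum (λ k → g (p ℕ.+ k)) (λ k → h (p ℕ.+ k)) n
  partialSum-+ g h zero n = ≈-sym (≈-trans (ℝ-Ring.+-identityˡ _) (ℝ-Ring.*-identityˡ _))
  partialSum-+ g h (suc p) n = begin-equality
    partialSum g h (suc p ℕ.+ n)
      ≈⟨ partialSum-suc g h (p ℕ.+ n) ⟩
    h 0 + g 0 * partialSum (g ∘ suc) (h ∘ suc) (p ℕ.+ n)
      ≈⟨ +-cong ≈-refl (*-cong ≈-refl (partialSum-+ (g ∘ suc) (h ∘ suc) p n)) ⟩
    h 0 + g 0 * (S + P * T)
      ≈⟨ pointwise-≈ (λ m → solve 5 (λ h g S P T →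
           h :+ g :* (S :+ P :* T) := (h :+ g :* S) :+ (g :* P) :* T) refl
           (seq (h 0) m) (seq (g 0) m) (seq S m) (seq P m) (seq T m)) ⟩
    (h 0 + g 0 * S) + (g 0 * P) * T
      ≈⟨ +-cong (≈-sym (partialSum-suc g h p)) ≈-refl ⟩
    partialSum g h (suc p) + (g 0 * P) * T ∎
    where
    S = partialSum (g ∘ suc) (h ∘ suc) p
    P = ∏ {p} (g ∘ suc ∘ toℕ)
    T = partialSum (λ k → g (suc p ℕ.+ k)) (λ k → h (suc p ℕ.+ k)) n

  discounted-cong : ∀ {g g′ h h′ : ℕ → ℝ} → (∀ k → g k ≈ g′ k) → (∀ k → h k ≈ h′ k) →
                    ∀ k → discounted g h k ≈ discounted g′ h′ k
  discounted-cong g≈g′ h≈h′ k = *-cong (∏-cong {k} (g≈g′ ∘ toℕ)) (h≈h′ k)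

  -- The sum over one period reproduces itself scaled by the weight w of the
  -- period, so the value is the fixed point of t ↦ S + w t.
  periodic-sum : ∀ g p → 0 ℕ.< p → (∀ k → g (p ℕ.+ k) ≈ g k) →
    0ℝ < ∏ {p} (g ∘ toℕ) → ∏ {p} (g ∘ toℕ) < 1ℝ →
    ∃[ z ] ∀ h → (∀ k → h (p ℕ.+ k) ≈ h k) → partialSum g h ⟶ z * partialSum g h p
  periodic-sum g p p>0 g-periodic w>0 w<1 = z , λ h h-periodic →
    let S = partialSum g h p in
    ⟶-fixpoint {partialSum g h} {S} {w} {z * S} {p} w>0 w<1 p>0
      (λ n → ≈-trans (partialSum-+ g h p n) (+-cong ≈-refl (*-cong ≈-refl
        (∑-cong {n} (discounted-cong g-periodic h-periodic ∘ toℕ)))))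
      (begin-equality
        S + w * (z * S)
          ≈⟨ +-cong (≈-sym (≈-trans (*-cong inverse ≈-refl) (ℝ-Ring.*-identityˡ S))) ≈-refl ⟩
        ((1ℝ - w) * z) * S + w * (z * S)
          ≈⟨ pointwise-≈ (λ m → solve 3 (λ w z S →
               ((con 1ℚ :- w) :* z) :* S :+ w :* (z :* S) := z :* S) refl
               (seq w m) (seq z m) (seq S m)) ⟩
        z * S ∎)
    where
    w = ∏ {p} (g ∘ toℕ)
    z = proj₁ (reciprocal {1ℝ - w} (x<y⇒0<y-x {w} {1ℝ} w<1))
    inverse : (1ℝ - w) * z ≈ 1ℝ
    inverse = proj₂ (reciprocal {1ℝ - w} (x<y⇒0<y-x {w} {1ℝ} w<1))

IsAffine : ∀ {n} → Pred (Vector ℝ n → ℝ) 0ℓ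
IsAffine {n} f = Σ (Vector ℝ n) λ a → ∃[ b ] ∀ x → f x ≈ ∑ (λ i → a i * x i) + b

indicator : ∀ {n} → Fin n → Vector ℝ n
indicator fzero    fzero    = 1ℝ
indicator fzero    (fsuc i) = 0ℝ
indicator (fsuc v) fzero    = 0ℝ
indicator (fsuc v) (fsuc i) = indicator v i

module _ where
  open +-*-Solver using (solve; _:=_; _:+_; _:*_; _:-_; :-_; con)
  open ≼-Reasoning

  ∑-zero : ∀ {n} (x : Vector ℝ n) → ∑ (λ i → 0ℝ * x i) ≈ 0ℝ
  ∑-zero {n} x = ≈-trans (∑-cong λ i → ℝ-Ring.zeroˡ (x i)) (Sum.sum-replicate-zero n)

  ∑-indicator : ∀ {n} (v : Fin n) (x : Vector ℝ n) → ∑ (λ i → indicator v i * x i) ≈ x v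
  ∑-indicator fzero    x = ≈-trans (+-cong (ℝ-Ring.*-identityˡ (x fzero)) (∑-zero (x ∘ fsuc)))
                                   (ℝ-Ring.+-identityʳ (x fzero))
  ∑-indicator (fsuc v) x = ≈-trans (+-cong (ℝ-Ring.zeroˡ (x fzero)) (∑-indicator v (x ∘ fsuc)))
                                   (ℝ-Ring.+-identityˡ (x (fsuc v)))

  affine-const : ∀ {n} b → IsAffine {n} (λ _ → b)
  affine-const b = (λ _ → 0ℝ) , b , λ x →
    ≈-sym (≈-trans (+-cong (∑-zero x) ≈-refl) (ℝ-Ring.+-identityˡ b))

  affine-coordinate : ∀ {n} (v : Fin n) → IsAffine (λ x → x v)
  affine-coordinate v = indicator v , 0ℝ , λ x →
    ≈-sym (≈-trans (ℝ-Ring.+-identityʳ _) (∑-indicator v x))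

  affine-+ : ∀ {n} {f g : Vector ℝ n → ℝ} → IsAffine f → IsAffine g →
             IsAffine (λ x → f x + g x)
  affine-+ {f = f} {g} (a , b , f≈) (a′ , b′ , g≈) =
    (λ i → a i + a′ i) , b + b′ , λ x →
    let S = ∑ (λ i → a i * x i); T = ∑ (λ i → a′ i * x i) in begin-equality
      f x + g x
        ≈⟨ +-cong (f≈ x) (g≈ x) ⟩
      (S + b) + (T + b′)
        ≈⟨ pointwise-≈ (λ m → solve 4 (λ S b T b′ → (S :+ b) :+ (T :+ b′) := (S :+ T) :+ (b :+ b′))
             refl (seq S m) (seq b m) (seq T m) (seq b′ m)) ⟩
      (S + T) + (b + b′)
        ≈⟨ +-cong (≈-sym (Sum.∑-distrib-+ (λ i → a i * x i) (λ i → a′ i * x i))) ≈-refl ⟩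
      ∑ (λ i → a i * x i + a′ i * x i) + (b + b′)
        ≈⟨ +-cong (∑-cong λ i → ≈-sym (ℝ-Ring.distribʳ (x i) (a i) (a′ i))) ≈-refl ⟩
      ∑ (λ i → (a i + a′ i) * x i) + (b + b′) ∎

  affine-* : ∀ {n} {f : Vector ℝ n → ℝ} c → IsAffine f → IsAffine (λ x → c * f x)
  affine-* {f = f} c (a , b , f≈) = (λ i → c * a i) , c * b , λ x → begin-equality
    c * f x
      ≈⟨ *-cong ≈-refl (f≈ x) ⟩
    c * (∑ (λ i → a i * x i) + b)
      ≈⟨ ℝ-Ring.distribˡ c _ b ⟩
    c * ∑ (λ i → a i * x i) + c * b
      ≈⟨ +-cong (Sum.*-distribˡ-sum c (λ i → a i * x i)) ≈-refl ⟩
    ∑ (λ i → c * (a i * x i)) + c * b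
      ≈⟨ +-cong (∑-cong λ i → ≈-sym (ℝ-Ring.*-assoc c (a i) (x i))) ≈-refl ⟩
    ∑ (λ i → (c * a i) * x i) + c * b ∎

  affine-∑ : ∀ {m n} {F : Fin m → Vector ℝ n → ℝ} → (∀ k → IsAffine (F k)) →
             IsAffine (λ x → ∑ (λ k → F k x))
  affine-∑ {zero}  F-affine = affine-const 0ℝ
  affine-∑ {suc m} F-affine = affine-+ (F-affine fzero) (affine-∑ (F-affine ∘ fsuc))

  polyhedron-≤ : ∀ {n} {f g : Vector ℝ n → ℝ} → IsAffine f → IsAffine g →
                 IsPolyhedron (λ x → f x ≤ g x)
  polyhedron-≤ {f = f} {g} f-affine g-affine =
    let a , b , f-g≈ = affine-+ f-affine (affine-* (- 1ℝ) g-affine) in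
    -- The difference f - g is a · x + b, so f ≤ g becomes a · x ≤ - b.
    (a , - b) ∷ [] , λ x →
    let S = ∑ (λ i → a i * x i)
        drop-b = pointwise-≈ {x = S} λ m → solve 2 (λ S b → S := (S :+ b) :+ :- b) refl (seq S m) (seq b m)
        drop-g = pointwise-≈ {x = (g x + (- 1ℝ) * g x) + - b} {y = - b} λ m →
          solve 2 (λ g b → (g :+ (:- con 1ℚ) :* g) :+ :- b := :- b) refl (seq (g x) m) (seq b m)
        add-g = pointwise-≈ {x = f x} λ m →
          solve 2 (λ f g → f := (f :+ (:- con 1ℚ) :* g) :+ g) refl (seq (f x) m) (seq (g x) m)
        drop-b′ = pointwise-≈ {y = g x} λ m →
          solve 2 (λ b g → (:- b :+ b) :+ g := g) refl (seq b m) (seq (g x) m)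
    in mk⇔
      (λ f≤g → ≼⇒≤ (begin
        S                                   ≈⟨ drop-b ⟩
        (S + b) + - b                       ≈⟨ +-cong (≈-sym (f-g≈ x)) ≈-refl ⟩
        (f x + (- 1ℝ) * g x) + - b          ≲⟨ +-mono-≼ (+-mono-≼ (wrap f≤g) ≼-refl) ≼-refl ⟩
        (g x + (- 1ℝ) * g x) + - b          ≈⟨ drop-g ⟩
        - b                                 ∎) ∷ [])
      λ { (S≤-b ∷ []) → ≼⇒≤ (begin
        f x                                 ≈⟨ add-g ⟩
        (f x + (- 1ℝ) * g x) + g x          ≈⟨ +-cong (f-g≈ x) ≈-refl ⟩
        (S + b) + g x                       ≲⟨ +-mono-≼ (+-mono-≼ (wrap S≤-b) ≼-refl) ≼-refl ⟩
        (- b + b) + g x                     ≈⟨ drop-b′ ⟩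
        g x                                 ∎) }

polyhedron-resp : ∀ {n} {Q R : Pred (Vector ℝ n) 0ℓ} → (∀ x → x ∈ Q ⇔ x ∈ R) →
                  IsPolyhedron Q → IsPolyhedron R
polyhedron-resp Q⇔R (H , Q⇔H) = H , λ x → mk⇔
  (Equivalence.to (Q⇔H x) ∘ Equivalence.from (Q⇔R x))
  (Equivalence.to (Q⇔R x) ∘ Equivalence.from (Q⇔H x))

polyhedron-× : ∀ {n} {Q R : Pred (Vector ℝ n) 0ℓ} → IsPolyhedron Q → IsPolyhedron R →
               IsPolyhedron (λ x → x ∈ Q × x ∈ R)
polyhedron-× (H , Q⇔H) (K , R⇔K) = H ++ K , λ x → mk⇔
  (λ (q , r) → All.++⁺ (Equivalence.to (Q⇔H x) q) (Equivalence.to (R⇔K x) r))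
  (λ h → Equivalence.from (Q⇔H x) (All.++⁻ˡ H h) , Equivalence.from (R⇔K x) (All.++⁻ʳ H h))

polyhedron-universe : ∀ {n} {Q : Pred (Vector ℝ n) 0ℓ} → (∀ x → x ∈ Q) → IsPolyhedron Q
polyhedron-universe Q-all = [] , λ x → mk⇔ (λ _ → []) (λ _ → Q-all x)

polyhedron-∀ : ∀ {m n} {Q : Fin m → Pred (Vector ℝ n) 0ℓ} → (∀ i → IsPolyhedron (Q i)) →
               IsPolyhedron (λ x → ∀ i → x ∈ Q i)
polyhedron-∀ {zero}  Q-polyhedron = polyhedron-universe λ _ ()
polyhedron-∀ {suc m} Q-polyhedron = polyhedron-resp
  (λ x → mk⇔ (λ { (q , _) fzero → q ; (_ , r) (fsuc i) → r i }) (λ q → q fzero , q ∘ fsuc))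
  (polyhedron-× (Q-polyhedron fzero) (polyhedron-∀ (Q-polyhedron ∘ fsuc)))

-- The list of half-spaces has to be given outright, so P is decided; when it fails, the list is
-- empty. In this way invalid codes impose nothing.
polyhedron-→ : ∀ {n} {P : Set} {Q : Pred (Vector ℝ n) 0ℓ} → Dec P → (P → IsPolyhedron Q) →
               IsPolyhedron (λ x → P → x ∈ Q)
polyhedron-→ (yes p) Q-polyhedron =
  polyhedron-resp (λ x → mk⇔ (λ q _ → q) (λ q → q p)) (Q-polyhedron p)
polyhedron-→ (no ¬p) _ = polyhedron-universe λ _ p → contradiction p ¬p

-- Walk lengths are natural numbers on which the types of codes depend, so the bound is a side
-- condition rather than part of the index type.
polyhedron-∀< : ∀ {m} N {Q : ℕ → Pred (Vector ℝ m) 0ℓ} → (∀ n → IsPolyhedron (Q n)) →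
                IsPolyhedron (λ x → ∀ n → n ℕ.< N → x ∈ Q n)
polyhedron-∀< N {Q} Q-polyhedron = polyhedron-resp
  (λ x → mk⇔
    (λ q n n<N → subst (λ k → x ∈ Q k) (Fin.toℕ-fromℕ< n<N) (q (fromℕ< n<N)))
    (λ q i → q (toℕ i) (Fin.toℕ<n i)))
  (polyhedron-∀ {N} (Q-polyhedron ∘ toℕ))

HasSum-cong : ∀ {f g s} → (∀ k → f k ≈ g k) → HasSum f s → HasSum g s
HasSum-cong {f} {g} {s} f≈g h =
  ⟶⇒HasSum {g} {s} (⟶-cong (λ n → ∑-cong {n} (f≈g ∘ toℕ)) (HasSum⇒⟶ {f} {s} h))

-- Walks

module _ (Γ : MarkedNetwork) where
  open MarkedNetwork Γ

  extend-affine : ∀ u → IsAffine (λ x → extend Γ x u)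
  extend-affine (inj₁ v) = affine-coordinate v
  extend-affine (inj₂ a) = affine-const (mark a)

  extend-mono : ∀ {x y} → x ≤ᵛ y → ∀ u → extend Γ x u ≼ extend Γ y u
  extend-mono x≤y (inj₁ v) = wrap (x≤y v)
  extend-mono x≤y (inj₂ a) = ≼-refl

  load : (u : Node) → E → Vector ℝ #V → ℝ
  load u e x = extend Γ x u + c e

  load-affine : ∀ u e → IsAffine (load u e)
  load-affine u e = affine-+ (extend-affine u) (affine-const (c e))

  load-mono : ∀ {x y} u e → x ≤ᵛ y → load u e x ≼ load u e y
  load-mono u e x≤y = +-mono-≼ (extend-mono x≤y u) ≼-refl

  *-monoʳ-≼-∏α : ∀ {n x y} (edge : Fin n → E) → x ≼ y → ∏ (α ∘ edge) * x ≼ ∏ (α ∘ edge) * y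
  *-monoʳ-≼-∏α edge = *-monoʳ-≼
    (eventually-nonneg {∏ (α ∘ edge)} (∏-pos (α ∘ edge) (α-pos ∘ edge)))

  module _ {n} (node : Fin (suc n) → Node) (edge : Fin n → E) where

    finiteΣ : Vector ℝ #V → ℝ
    finiteΣ x = ∑ (λ k → ∏ (λ (j : Fin′ k) → α (edge (inject j))) * load (node (inject₁ k)) (edge k) x)
      + ∏ (α ∘ edge) * extend Γ x (node (fromℕ n))

    finiteΣ-affine : IsAffine finiteΣ
    finiteΣ-affine = affine-+
      (affine-∑ λ k → affine-* (∏ (λ (j : Fin′ k) → α (edge (inject j))))
                        (load-affine (node (inject₁ k)) (edge k)))
      (affine-* (∏ (α ∘ edge)) (extend-affine (node (fromℕ n))))

    finiteΣ-mono : ∀ {x y} → x ≤ᵛ y → finiteΣ x ≼ finiteΣ y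
    finiteΣ-mono x≤y = +-mono-≼
      (∑-mono λ k → *-monoʳ-≼-∏α (λ (j : Fin′ k) → edge (inject j))
                      (load-mono (node (inject₁ k)) (edge k) x≤y))
      (*-monoʳ-≼-∏α edge (extend-mono x≤y (node (fromℕ n))))

  -- Carries the sum of a decoded walk over to the original one, whose nodes and edges agree with it
  -- only pointwise.
  finiteΣ-cong : ∀ {n} {node node′ : Fin (suc n) → Node} {edge edge′ : Fin n → E} →
    (∀ i → node i ≡ node′ i) → (∀ i → edge i ≡ edge′ i) →
    ∀ x → finiteΣ node edge x ≈ finiteΣ node′ edge′ x
  finiteΣ-cong {n} node≡ edge≡ x = +-cong
    (∑-cong λ k → *-cong
      (∏-cong λ (j : Fin′ k) → ℝ-Ring.reflexive (cong α (edge≡ (inject j))))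
      (ℝ-Ring.reflexive (cong₂ (λ u e → load u e x) (node≡ (inject₁ k)) (edge≡ k))))
    (*-cong (∏-cong λ j → ℝ-Ring.reflexive (cong α (edge≡ j)))
            (ℝ-Ring.reflexive (cong (extend Γ x) (node≡ (fromℕ n)))))

  infiniteΣ-term : (ℕ → Node) → (ℕ → E) → Vector ℝ #V → ℕ → ℝ
  infiniteΣ-term node edge x = discounted (α ∘ edge) (λ k → load (node k) (edge k) x)

  infiniteΣ-cong : ∀ {node node′ : ℕ → Node} {edge edge′ : ℕ → E} →
    (∀ i → node i ≡ node′ i) → (∀ i → edge i ≡ edge′ i) →
    ∀ {x σ} → HasSum (infiniteΣ-term node edge x) σ → HasSum (infiniteΣ-term node′ edge′ x) σ
  infiniteΣ-cong {node} {node′} {edge} {edge′} node≡ edge≡ {x} {σ} = HasSum-cong {s = σ}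
    (discounted-cong (λ k → ℝ-Ring.reflexive (cong α (edge≡ k)))
      (λ k → ℝ-Ring.reflexive (cong₂ (λ u e → load u e x) (node≡ k) (edge≡ k))))

  -- Weak inequalities pass to limits, which settles infinite walks. With y = x the lemma compares
  -- two values of one sum.
  HasΣ-mono : ∀ W {x y σ τ} → HasΣ Γ W x σ → HasΣ Γ W y τ → x ≤ᵛ y → σ ≼ τ
  HasΣ-mono (finite W _ _) σ≃ τ≃ x≤y =
    ≼-trans (≈⇒≼ (wrap σ≃)) (≼-trans (finiteΣ-mono node edge x≤y) (≈⇒≽ (wrap τ≃)))
    where open FiniteWalk W
  HasΣ-mono (infinite W _) {x} {y} {σ} {τ} xσ yτ x≤y = ⟶-mono
    (HasSum⇒⟶ {infiniteΣ-term node edge x} {σ} xσ) (HasSum⇒⟶ {infiniteΣ-term node edge y} {τ} yτ)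
    (λ n → ∑-mono {n} λ k → *-monoʳ-≼-∏α (edge ∘ toℕ {toℕ k}) (load-mono (node (toℕ k)) (edge (toℕ k)) x≤y))
    where open InfiniteWalk W

  -- Sums along monocycles

  module MonocycleSum (gainy : IsGainy Γ) (W : InfiniteWalk Γ) (monocycle : IsMonocycle Γ W) where
    open InfiniteWalk W

    s r p : ℕ
    s = proj₁ monocycle
    r = proj₁ (proj₂ monocycle)
    p = suc r ℕ.∸ s

    s≤r : s ℕ.≤ r
    s≤r = proj₁ (proj₂ (proj₂ monocycle))

    node-injective : ∀ i j → i ℕ.≤ r → j ℕ.≤ r → node i ≡ node j → i ≡ j
    node-injective = proj₁ (proj₂ (proj₂ (proj₂ monocycle)))

    s+p≡1+r : s ℕ.+ p ≡ suc r
    s+p≡1+r = ℕ.m+[n∸m]≡n (ℕ.m≤n⇒m≤1+n s≤r)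

    p>0 : 0 ℕ.< p
    p>0 = ℕ.m<n⇒0<n∸m (ℕ.s≤s s≤r)

    edge-periodic : ∀ k → edge (s ℕ.+ (p ℕ.+ k)) ≡ edge (s ℕ.+ k)
    edge-periodic k = trans
      (cong edge (trans (cong (s ℕ.+_) (ℕ.+-comm p k)) (sym (ℕ.+-assoc s k p))))
      (proj₂ (proj₂ (proj₂ (proj₂ monocycle))) (s ℕ.+ k) (ℕ.m≤m+n s k))

    node-periodic : ∀ k → node (s ℕ.+ (p ℕ.+ k)) ≡ node (s ℕ.+ k)
    node-periodic k = trans (sym (src≡ _)) (trans (cong src (edge-periodic k)) (src≡ _))

    -- Cut out so that `IsGainy` applies; its weight unfolds to the product of `cycleα` over one
    -- period.
    cycle : FiniteWalk Γ
    cycle = record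
      { length = p
      ; node   = λ i → node (s ℕ.+ toℕ i)
      ; edge   = λ i → edge (s ℕ.+ toℕ i)
      ; src≡   = λ i → trans (src≡ _) (cong (λ k → node (s ℕ.+ k)) (sym (Fin.toℕ-inject₁ i)))
      ; tgt≡   = λ i → trans (tgt≡ _) (cong node (sym (ℕ.+-suc s (toℕ i))))
      }

    cycle-isCycle : IsCycle Γ cycle
    cycle-isCycle = p>0
      , trans (cong (λ k → node (s ℕ.+ k)) (trans (Fin.toℕ-fromℕ p) (sym (ℕ.+-identityʳ p))))
              (node-periodic 0)
      , λ {i} {j} eq → Fin.toℕ-injective (trans (sym (Fin.toℕ-inject₁ i)) (trans
          (ℕ.+-cancelˡ-≡ s _ _ (node-injective _ _ (below-r i) (below-r j) eq))
          (Fin.toℕ-inject₁ j)))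
      where
      -- Here `inject₁` leaves out the closing node, whose index s + p = r + 1 is beyond the reach
      -- of `node-injective`.
      below-r : (i : Fin p) → s ℕ.+ toℕ (inject₁ i) ℕ.≤ r
      below-r i = ℕ.s≤s⁻¹ (subst₂ ℕ._≤_
        (trans (ℕ.+-suc s (toℕ i)) (cong (λ k → suc (s ℕ.+ k)) (sym (Fin.toℕ-inject₁ i)))) s+p≡1+r
        (ℕ.+-monoʳ-≤ s (Fin.toℕ<n i)))

    cycleα : ℕ → ℝ
    cycleα k = α (edge (s ℕ.+ k))

    loads cycleLoad : Vector ℝ #V → ℕ → ℝ
    loads     x k = load (node k) (edge k) x
    cycleLoad x k = load (node (s ℕ.+ k)) (edge (s ℕ.+ k)) x

    cycle-sum : ∃[ z ] ∀ h → (∀ k → h (p ℕ.+ k) ≈ h k) →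
                partialSum cycleα h ⟶ z * partialSum cycleα h p
    cycle-sum = periodic-sum cycleα p p>0
      (λ k → ℝ-Ring.reflexive (cong α (edge-periodic k)))
      (∏-pos {p} (cycleα ∘ toℕ) (λ i → α-pos (edge (s ℕ.+ toℕ i))))
      (gainy cycle cycle-isCycle)

    -- The factor `proj₁ cycle-sum` is the reciprocal of 1 - w, chosen before the loads; x therefore
    -- enters only through two finite sums.
    value : Vector ℝ #V → ℝ
    value x = partialSum (α ∘ edge) (loads x) s +
      ∏ {s} (α ∘ edge ∘ toℕ) * (proj₁ cycle-sum * partialSum cycleα (cycleLoad x) p)

    value-affine : IsAffine value
    value-affine = affine-+
      (affine-∑ {s} λ k → affine-* (∏ {toℕ k} (α ∘ edge ∘ toℕ))
        (load-affine (node (toℕ k)) (edge (toℕ k))))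
      (affine-* _ (affine-* _ (affine-∑ {p} λ k →
        affine-* (∏ {toℕ k} (cycleα ∘ toℕ))
          (load-affine (node (s ℕ.+ toℕ k)) (edge (s ℕ.+ toℕ k))))))

    value-sum : ∀ x → HasSum (infiniteΣ-term node edge x) (value x)
    value-sum x = ⟶⇒HasSum {infiniteΣ-term node edge x} {value x} (⟶-shift s
      (⟶-cong (λ n → ≈-sym (partialSum-+ (α ∘ edge) (loads x) s n))
        (⟶-affine _ _ (proj₂ cycle-sum (cycleLoad x) λ k →
          ℝ-Ring.reflexive (cong₂ (λ u e → load u e x) (node-periodic k) (edge-periodic k))))))

  -- Downward closure needs a value at the smaller point, the polyhedron needs the value to be
  -- affine in the point; one construction serves both.
  HasΣ-affine : IsGainy Γ → ∀ W → W ∈ Ŵ Γ →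
                Σ (Vector ℝ #V → ℝ) λ f → IsAffine f × ∀ x → HasΣ Γ W x (f x)
  HasΣ-affine gainy (finite W _ _) _ =
    finiteΣ node edge , finiteΣ-affine node edge , λ x → ≈⇒≃ (≈-refl {finiteΣ node edge x})
    where open FiniteWalk W
  HasΣ-affine gainy (infinite W _) monocycle = value , value-affine , value-sum
    where open MonocycleSum gainy W monocycle

  -- P says that a real number is a value of Σ(W)(x). As a parameter it can also be given unfolded,
  -- as in the types of `decode`.
  Constraint : A → E → Pred ℝ 0ℓ → Set
  Constraint a e P = ∃[ σ ] P σ × α e * σ + c e ≤ mark a

  constraint-antitone : ∀ {a e} {σ τ} → σ ≼ τ → α e * τ + c e ≤ mark a → α e * σ + c e ≤ mark a
  constraint-antitone {a} {e} {σ} {τ} σ≼τ h = ≼⇒≤ {α e * σ + c e} {mark a} (≼-trans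
    (+-mono-≼ {α e * σ} {α e * τ} (*-monoʳ-≼ (eventually-nonneg {α e} (α-pos e)) σ≼τ) ≼-refl)
    (wrap {α e * τ + c e} h))

  ≤ᵛ-refl : ∀ {n} {x : Vector ℝ n} → x ≤ᵛ x
  ≤ᵛ-refl {x = x} i = ≼⇒≤ (≼-refl {x i})

  -- The constraint asks for some σ. The affine formula provides one that is at most any other, so
  -- the existential reduces to a single inequality.
  constraint-polyhedron : IsGainy Γ → ∀ a e W → W ∈ Ŵ Γ →
                          IsPolyhedron (λ x → Constraint a e (HasΣ Γ W x))
  constraint-polyhedron gainy a e W W∈Ŵ =
    let f , f-affine , f-sum = HasΣ-affine gainy W W∈Ŵ in
    polyhedron-resp
      (λ x → mk⇔ (λ h → f x , f-sum x , h)
        (λ (σ , xσ , h) → constraint-antitone {a} {e}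
          (HasΣ-mono W (f-sum x) xσ (≤ᵛ-refl {x = x})) h))
      (polyhedron-≤ {f = λ x → α e * f x + c e} {λ _ → mark a}
        (affine-+ (affine-* (α e) f-affine) (affine-const (c e))) (affine-const (mark a)))

  -- Finite enumeration of paths and monocycles

  _≟-Node_ : DecidableEquality Node
  _≟-Node_ = Sum⊎.≡-dec Fin._≟_ Fin._≟_

  isUnmarked? : ∀ u → Dec (IsUnmarked Γ u)
  isUnmarked? (inj₁ v) = yes (v , refl)
  isUnmarked? (inj₂ a) = no λ ()

  isMarked? : ∀ u → Dec (IsMarked Γ u)
  isMarked? (inj₁ v) = no λ ()
  isMarked? (inj₂ a) = yes (a , refl)

  #Node : ℕ
  #Node = #V ℕ.+ #A

  -- Pigeonhole principle, after embedding the nodes in `Fin #Node` by `join`, which `splitAt`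
  -- undoes.
  distinct-nodes-bounded : ∀ {n} {node : Fin n → Node} → Injective _≡_ _≡_ node → n ℕ.≤ #Node
  distinct-nodes-bounded node-injective = Fin.injective⇒≤ λ eq → node-injective
    (trans (sym (Fin.splitAt-join #V #A _)) (trans (cong (splitAt #V) eq) (Fin.splitAt-join #V #A _)))

  -- Edges determine the path: it starts at `tgt e`, and each further node is the target of the edge
  -- before it. This also covers paths of length 0.
  module PathCode (e : E) {n} (g : Fin n → E) where

    pathNode : Fin (suc n) → Node
    pathNode fzero    = tgt e
    pathNode (fsuc i) = tgt (g i)

    -- Distinctness is written with explicit indices so that every clause can be decided by search
    -- over `Fin`.
    IsPathCode : Set
    IsPathCode = (∀ i → src (g i) ≡ pathNode (inject₁ i))
               × (∀ i → IsUnmarked Γ (pathNode (inject₁ i)))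
               × IsMarked Γ (pathNode (fromℕ n))
               × (∀ i j → pathNode i ≡ pathNode j → i ≡ j)

    isPathCode? : Dec IsPathCode
    isPathCode? = Fin.all? (λ i → src (g i) ≟-Node pathNode (inject₁ i))
      ×-dec Fin.all? (λ i → isUnmarked? (pathNode (inject₁ i)))
      ×-dec isMarked? (pathNode (fromℕ n))
      ×-dec Fin.all? (λ i → Fin.all? λ j → (pathNode i ≟-Node pathNode j) →-dec (i Fin.≟ j))

    module _ (code : IsPathCode) where

      walk : FiniteWalk Γ
      walk = record
        { length = n ; node = pathNode ; edge = g ; src≡ = proj₁ code ; tgt≡ = λ _ → refl }

      walk-unmarked : ∀ i → IsUnmarked Γ (pathNode (inject₁ i))
      walk-unmarked = proj₁ (proj₂ code)

      walk-marked : IsMarked Γ (pathNode (fromℕ n))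
      walk-marked = proj₁ (proj₂ (proj₂ code))

      walk-isPath : IsPath Γ walk
      walk-isPath = proj₂ (proj₂ (proj₂ code)) _ _

  PathConstraints : A → E → Pred (Vector ℝ #V) 0ℓ
  PathConstraints a e x = ∀ W unmarked marked → IsPath Γ W → FiniteWalk.node W fzero ≡ tgt e →
    Constraint a e (HasΣ Γ (finite W unmarked marked) x)

  pathConstraints-polyhedron : IsGainy Γ → ∀ a e → IsPolyhedron (PathConstraints a e)
  pathConstraints-polyhedron gainy a e = polyhedron-resp
    (λ x → mk⇔ (decode x) (λ h n _ k code →
      let open PathCode e {n} (finToFun k) in
      h (walk code) (walk-unmarked code) (walk-marked code) (walk-isPath code) refl))
    -- A path with n edges has n + 1 distinct nodes, hence n < `#Node`.
    (polyhedron-∀< #Node λ n → polyhedron-∀ λ k →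
      let open PathCode e {n} (finToFun k) in
      polyhedron-→ isPathCode? λ code → constraint-polyhedron gainy a e
        (finite (walk code) (walk-unmarked code) (walk-marked code)) (walk-isPath code))
    where
    decode : ∀ x → (∀ n → n ℕ.< #Node → ∀ k → let open PathCode e {n} (finToFun k) in IsPathCode →
                     Constraint a e (λ σ → σ ≃ finiteΣ pathNode (finToFun k) x)) →
             x ∈ PathConstraints a e
    decode x h W unmarked marked path start≡ =
      let σ , σ≃ , bound = h length (distinct-nodes-bounded path) (funToFin edge) code
      in σ , ≈⇒≃ (≈-trans {σ} (wrap σ≃) (finiteΣ-cong node≡ edge≡ x)) , bound
      where
      open FiniteWalk W
      open PathCode e {length} (finToFun (funToFin edge))
      edge≡ : ∀ i → finToFun (funToFin edge) i ≡ edge i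
      edge≡ = Fin.finToFun-funToFin edge
      node≡ : ∀ i → pathNode i ≡ node i
      node≡ fzero    = sym start≡
      node≡ (fsuc i) = trans (cong tgt (edge≡ i)) (tgt≡ i)
      code : IsPathCode
      code = (λ i → trans (cong src (edge≡ i)) (trans (src≡ i) (sym (node≡ (inject₁ i)))))
           , (λ i → subst (IsUnmarked Γ) (sym (node≡ (inject₁ i))) (unmarked i))
           , subst (IsMarked Γ) (sym (node≡ (fromℕ length))) marked
           , λ i j eq → path (trans (sym (node≡ i)) (trans eq (node≡ j)))

  -- The r + 1 edges of g run once through stem and cycle, and the last returns to index s. Every
  -- node has an outgoing edge here, so nodes are read off as sources; a path needs targets because
  -- of its marked end.
  module MonocycleCode (e : E) {r} (s : Fin (suc r)) (g : Fin (suc r) → E) where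

    next : Fin (suc r) → Fin (suc r)
    next i with r ℕ.≟ toℕ i
    ... | yes _  = s
    ... | no r≢i = fsuc (lower₁ i r≢i)

    next-wrap : ∀ {i} → r ≡ toℕ i → next i ≡ s
    next-wrap {i} r≡i with r ℕ.≟ toℕ i
    ... | yes _  = refl
    ... | no r≢i = contradiction r≡i r≢i

    next-suc : ∀ {i} → r ≢ toℕ i → toℕ (next i) ≡ suc (toℕ i)
    next-suc {i} r≢i with r ℕ.≟ toℕ i
    ... | yes r≡i = contradiction r≡i r≢i
    ... | no r≢i′ = cong suc (Fin.toℕ-lower₁ i r≢i′)

    position : ℕ → Fin (suc r)
    position zero    = fzero
    position (suc i) = next (position i)

    toℕ-position : ∀ i → i ℕ.≤ r → toℕ (position i) ≡ i
    toℕ-position zero    _   = refl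
    toℕ-position (suc i) i<r = trans
      (next-suc λ r≡ → ℕ.<⇒≢ i<r (sym (trans r≡ i≡))) (cong suc i≡)
      where
      i≡ = toℕ-position i (ℕ.<⇒≤ i<r)

    -- Index r is followed by s, so steps r + 1 and s reach the same position; from there both sides
    -- advance by the same `next`.
    position-periodic : ∀ i → toℕ s ℕ.≤ i → position (i ℕ.+ (suc r ℕ.∸ toℕ s)) ≡ position i
    position-periodic i s≤i =
      subst (λ k → position (k ℕ.+ (suc r ℕ.∸ toℕ s)) ≡ position k) (ℕ.m∸n+n≡m s≤i)
        (from-s (i ℕ.∸ toℕ s))
      where
      s≤r : toℕ s ℕ.≤ r
      s≤r = ℕ.s≤s⁻¹ (Fin.toℕ<n s)
      -- The offset m stands leftmost so that a successor in it unfolds to one `next`.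
      from-s : ∀ m → position ((m ℕ.+ toℕ s) ℕ.+ (suc r ℕ.∸ toℕ s)) ≡ position (m ℕ.+ toℕ s)
      from-s zero    = trans (cong position (ℕ.m+[n∸m]≡n (ℕ.m≤n⇒m≤1+n s≤r)))
        (trans (next-wrap (sym (toℕ-position r ℕ.≤-refl)))
               (sym (Fin.toℕ-injective (toℕ-position (toℕ s) s≤r))))
      from-s (suc m) = cong next (from-s m)

    IsMonocycleCode : Set
    IsMonocycleCode = src (g fzero) ≡ tgt e
                    × (∀ i → tgt (g i) ≡ src (g (next i)))
                    × (∀ i → IsUnmarked Γ (src (g i)))
                    × (∀ i j → src (g i) ≡ src (g j) → i ≡ j)

    isMonocycleCode? : Dec IsMonocycleCode
    isMonocycleCode? = (src (g fzero) ≟-Node tgt e)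
      ×-dec Fin.all? (λ i → tgt (g i) ≟-Node src (g (next i)))
      ×-dec Fin.all? (λ i → isUnmarked? (src (g i)))
      ×-dec Fin.all? (λ i → Fin.all? λ j → (src (g i) ≟-Node src (g j)) →-dec (i Fin.≟ j))

    module _ (code : IsMonocycleCode) where

      walk : InfiniteWalk Γ
      walk = record
        { node = src ∘ g ∘ position ; edge = g ∘ position
        ; src≡ = λ _ → refl ; tgt≡ = proj₁ (proj₂ code) ∘ position }

      walk-unmarked : ∀ i → IsUnmarked Γ (src (g (position i)))
      walk-unmarked = proj₁ (proj₂ (proj₂ code)) ∘ position

      walk-isMonocycle : IsMonocycle Γ walk
      walk-isMonocycle = toℕ s , r , ℕ.s≤s⁻¹ (Fin.toℕ<n s)
        , (λ i j i≤r j≤r eq → trans (sym (toℕ-position i i≤r))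
            (trans (cong toℕ (proj₂ (proj₂ (proj₂ code)) _ _ eq)) (toℕ-position j j≤r)))
        , λ i s≤i → cong g (position-periodic i s≤i)

  MonocycleConstraints : A → E → Pred (Vector ℝ #V) 0ℓ
  MonocycleConstraints a e x = ∀ W unmarked → IsMonocycle Γ W → InfiniteWalk.node W 0 ≡ tgt e →
    Constraint a e (HasΣ Γ (infinite W unmarked) x)

  monocycleConstraints-polyhedron : IsGainy Γ → ∀ a e → IsPolyhedron (MonocycleConstraints a e)
  monocycleConstraints-polyhedron gainy a e = polyhedron-resp
    (λ x → mk⇔ (decode x) (λ h r _ s k code →
      let open MonocycleCode e {r} s (finToFun k) in
      h (walk code) (walk-unmarked code) (walk-isMonocycle code) (proj₁ code)))
    -- Indices 0 to r carry r + 1 distinct nodes, hence r < `#Node`.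
    (polyhedron-∀< #Node λ r → polyhedron-∀ λ s → polyhedron-∀ λ k →
      let open MonocycleCode e {r} s (finToFun k) in
      polyhedron-→ isMonocycleCode? λ code →
        constraint-polyhedron gainy a e (infinite (walk code) (walk-unmarked code)) (walk-isMonocycle code))
    where
    decode : ∀ x → (∀ r → r ℕ.< #Node → ∀ s k →
                     let open MonocycleCode e {r} s (finToFun k) in IsMonocycleCode →
                     Constraint a e (HasSum
                       (infiniteΣ-term (src ∘ finToFun k ∘ position) (finToFun k ∘ position) x))) →
             x ∈ MonocycleConstraints a e
    decode x h W unmarked (s , r , s≤r , injective , periodic) start≡ =
      let σ , xσ , bound = h r r<#Node s′ (funToFin {suc r} (edge ∘ toℕ)) code
      in σ , infiniteΣ-cong
               (λ i → trans (cong src (position≡ i)) (src≡ i)) position≡ {x} {σ} xσ , bound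
      where
      open InfiniteWalk W
      s′ : Fin (suc r)
      s′ = fromℕ< (ℕ.s≤s s≤r)
      g : Fin (suc r) → E
      g = finToFun (funToFin {suc r} (edge ∘ toℕ))
      open MonocycleCode e s′ g
      g≡ : ∀ i → g i ≡ edge (toℕ i)
      g≡ = Fin.finToFun-funToFin {suc r} (edge ∘ toℕ)
      src-g≡ : ∀ i → src (g i) ≡ node (toℕ i)
      src-g≡ i = trans (cong src (g≡ i)) (src≡ (toℕ i))
      distinct : ∀ {i j : Fin (suc r)} → node (toℕ i) ≡ node (toℕ j) → i ≡ j
      distinct {i} {j} eq = Fin.toℕ-injective
        (injective _ _ (ℕ.s≤s⁻¹ (Fin.toℕ<n i)) (ℕ.s≤s⁻¹ (Fin.toℕ<n j)) eq)
      r<#Node : r ℕ.< #Node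
      r<#Node = distinct-nodes-bounded {node = node ∘ toℕ} distinct
      wrap-around : ∀ m → edge (suc r ℕ.+ m) ≡ edge (s ℕ.+ m)
      wrap-around m = trans
        (cong edge (trans (cong (ℕ._+ m) (sym (ℕ.m+[n∸m]≡n (ℕ.m≤n⇒m≤1+n s≤r))))
          (trans (ℕ.+-assoc s p m) (trans (cong (s ℕ.+_) (ℕ.+-comm p m)) (sym (ℕ.+-assoc s m p))))))
        (periodic (s ℕ.+ m) (ℕ.m≤m+n s m))
        where
        p = suc r ℕ.∸ s
      -- By periodicity the edges after index r continue as they do from s; before r, `next` is the
      -- ordinary successor.
      edge-next : ∀ i m → edge (suc (toℕ i) ℕ.+ m) ≡ edge (toℕ (next i) ℕ.+ m)
      edge-next i m with r ℕ.≟ toℕ i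
      ... | yes r≡i = trans (cong (λ k → edge (suc k ℕ.+ m)) (sym r≡i))
        (trans (wrap-around m)
          (cong (λ k → edge (k ℕ.+ m)) (sym (Fin.toℕ-fromℕ< (ℕ.s≤s s≤r)))))
      ... | no r≢i = cong (λ k → edge (suc k ℕ.+ m)) (sym (Fin.toℕ-lower₁ i r≢i))
      -- The statement is about whole tails of the edge sequence because an
      -- edge does not determine the edge after it.
      edge-position : ∀ i m → edge (i ℕ.+ m) ≡ edge (toℕ (position i) ℕ.+ m)
      edge-position zero    m = refl
      edge-position (suc i) m = trans (cong edge (sym (ℕ.+-suc i m)))
        (trans (edge-position i (suc m))
          (trans (cong edge (ℕ.+-suc (toℕ (position i)) m)) (edge-next (position i) m)))
      position≡ : ∀ i → g (position i) ≡ edge i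
      position≡ i = trans (g≡ (position i)) (trans
        (cong edge (sym (ℕ.+-identityʳ (toℕ (position i)))))
        (trans (sym (edge-position i 0)) (cong edge (ℕ.+-identityʳ i))))
      code : IsMonocycleCode
      code = trans (src-g≡ fzero) start≡
           -- At i = r the cycle closes: edge r + 1 equals edge s, so their sources agree.
           , (λ i → trans (cong tgt (g≡ i)) (trans (tgt≡ (toℕ i)) (trans (sym (src≡ (suc (toℕ i))))
               (cong src (trans (cong (edge ∘ suc) (sym (ℕ.+-identityʳ (toℕ i))))
                 (trans (edge-next i 0) (trans (cong edge (ℕ.+-identityʳ (toℕ (next i)))) (sym (g≡ (next i))))))))))
           , (λ i → subst (IsUnmarked Γ) (sym (src-g≡ i)) (unmarked (toℕ i)))
           , λ i j eq → distinct (trans (sym (src-g≡ i)) (trans eq (src-g≡ j)))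

  -- The condition over `𝒲` is split by constructor, since paths and monocycles are coded
  -- differently.
  𝒞-polyhedron : IsGainy Γ → IsPolyhedron (𝒞 Γ)
  𝒞-polyhedron gainy = polyhedron-resp
    (λ x → mk⇔
      (λ (x≥0 , h) → x≥0 , λ { a e (finite W u m) src≡ path start≡ → proj₁ (h a e src≡) W u m path start≡
                             ; a e (infinite W u) src≡ mono start≡ → proj₂ (h a e src≡) W u mono start≡ })
      (λ (x≥0 , h) → x≥0 , λ a e src≡ →
        (λ W u m path start≡ → h a e (finite W u m) src≡ path start≡) ,
        (λ W u mono start≡ → h a e (infinite W u) src≡ mono start≡)))
    (polyhedron-×
      (polyhedron-∀ λ i → polyhedron-≤ (affine-const 0ℝ) (affine-coordinate i))
      (polyhedron-∀ λ a → polyhedron-∀ λ e → polyhedron-→ (src e ≟-Node inj₂ a) λ _ →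
        polyhedron-× (pathConstraints-polyhedron gainy a e) (monocycleConstraints-polyhedron gainy a e)))

corollary4p4 : (Γ : MarkedNetwork) → IsGainy Γ → AllSinksMarked Γ → IsAntiBlocking (𝒞 Γ)
corollary4p4 Γ gainy _ = record
  { polyhedron  = 𝒞-polyhedron Γ gainy
  ; nonNegative = λ _ → proj₁
  ; downClosed  = λ x y (_ , y-bounded) x≥0 x≤y → x≥0 , λ a e W src≡ W∈Ŵ start≡ →
      -- The value at x comes from the affine formula, τ from the membership of y; monotonicity then
      -- compares the two.
      let f , _ , f-sum = HasΣ-affine Γ gainy W W∈Ŵ
          τ , yτ , bound = y-bounded a e W src≡ W∈Ŵ start≡
      in f x , f-sum x , constraint-antitone Γ {a} {e} (HasΣ-mono Γ W (f-sum x) yτ x≤y) bound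
  }
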